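{- Every IMCGD can be extended into a vertex-preserving, invisible matter quiescent CGD over $\overline{\mathcal{Y}}$.
   Context: Fix finite sets $\pi$ (ports), $\Sigma,\Delta$ (labels), with $m\notin\Sigma$, $m,l,r\notin\pi$. A graph has an at most countable vertex set, edges $\{u:a,v:b\}$ (unordered, $a,b$ ports) with each vertex–port pair in at most one edge, partial vertex and edge labels, and is connected. Pointed graphs modulo are isomorphism classes of pointed graphs under renamings preserving edges, ports, labels and pointer. In a pointed graph modulo $X$, vertices are designated by paths (words of port pairs $ab$, "leave by $a$, arrive by $b$", from the pointer), identified when reaching the same vertex; $V(X)$ is the vertex set, "." concatenation, $X_u$ the re-pointing at $u$, $X^r$ the disk of radius $r$ (subgraph induced by vertices at distance $\le r+1$ from the pointer, labels kept only on vertices at distance $\le r$ and edges between them). A dynamics $(F,R_\bullet)$ over a set $\mathcal{S}$ of pointed graphs modulo is $F:\mathcal{S}\to\mathcal{S}$ with maps $R_X:V(X)\to V(F(X))$; continuous: for all $X,m$ there is $n$ with $F(X)^m=F(X^n)^m$, $\mathrm{dom}\,R_X^m\subseteq V(X^n)$, $R_X^m=R_{X^n}^m$ ($R_X^m$ = restriction of $R_X$ to vertices mapped into $F(X)^m$); shift-invariant: $F(X_u)=F(X)_{R_X(u)}$, $R_X(u.v)=R_X(u).R_{X_u}(v)$; bounded: there is $b$ such that every $w'\in V(F(X))$ is $u'.v'$ with $u'\in\mathrm{Im}R_X$, $v'\in V(F(X)^b_{u'})$. A CGD over $\mathcal{S}$ is a continuous, shift-invariant, bounded dynamics over $\mathcal{S}$.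 Let $\mathcal{X}'=\mathcal{X}_{\Sigma\cup\{m\},\Delta,\pi\cup\{m,l,r\}}$; $T$ is the infinite rooted binary tree, all vertices labelled $m$, each vertex linked via port $l$ (resp. $r$) to port $m$ of its left (resp. right) child. Each $X\in\mathcal{X}_{\Sigma,\Delta,\pi}$ is identified with the graph of $\mathcal{X}'$ obtained by attaching to each vertex $v$ a copy of $T$ whose root's port $m$ is linked to port $m$ of $v$; $\mathcal{Y}$ is the set of all such graphs pointed at any vertex. $X_{\bullet s}=X_{mm.s}$, $s\in\{lm,rm\}^*$. A dynamics over a set $\mathcal{S}\supseteq\mathcal{Y}$ is invisible matter quiescent if there is $b$ with $R_{X_{\bullet s}}(t)=t$ for all $X\in\mathcal{X}_{\Sigma,\Delta,\pi}$ and $s,t\in\{lm,rm\}^*$ with $|s|\ge b$; vertex-preserving if every $R_Y$ is bijective. An IMCGD is a vertex-preserving invisible matter quiescent CGD over $\mathcal{Y}$. $\overline{\mathcal{Y}}$ is the set of $Y'\in\mathcal{X}'$ such that for every $r$ there is $Y\in\mathcal{Y}$ with $Y^r=Y'^r$. An extension of $(F,R_\bullet)$ over $\mathcal{Y}$ to $\overline{\mathcal{Y}}$ is a dynamics over $\overline{\mathcal{Y}}$ agreeing with $(F,R_\bullet)$ on $\mathcal{Y}$.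
   Formalization: Continuity over S compares F(X)^m and R_X^m with F(X')^m and R_{X'}^m for every X' in S having X'^n = X^n, because the disk X^n itself does not lie in 𝒴 or its closure, so F(X^n) is undefined there. -}

module Defs where

open import Data.Nat using (ℕ; zero; suc; _≤_)
open import Data.Bool using (Bool; true; false)
open import Data.List using (List; []; _∷_; length; map)
open import Data.Product using (Σ; ∃; ∃₂; _×_; _,_)
open import Data.Sum using (_⊎_; inj₁; inj₂)
open import Data.Unit using (⊤; tt)
open import Data.Fin using (Fin)
open import Function using (_⇔_)
open import Function.Definitions using (Bijective)
open import Relation.Binary.PropositionalEquality using (_≡_)

-- Raw (port-)graphs.  L = vertex labels, D = edge labels, P = ports.
-- E u a v b  means there is an edge {u:a, v:b}.
-- HasLab v l : vertex v carries label l (partial labelling).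
-- HasELab v a d : the edge at vertex-port v:a carries label d.
-- Well-formedness (symmetry, at most one edge per vertex-port pair,
-- functionality of labels, connectedness) is the predicate IsGraph.

record Graph (L D P : Set) : Set₁ where
  field
    V       : Set
    E       : V → P → V → P → Set
    pt      : V
    HasLab  : V → L → Set
    HasELab : V → P → D → Set
open Graph public

-- paths: words of port pairs ab ("leave by a, arrive by b")
Word : Set → Set
Word P = List (P × P)

module _ {L D P : Set} (G : Graph L D P) where

  data Walk : V G → Word P → V G → Set where
    []   : ∀ {u} → Walk u [] u
    step : ∀ {u a v b w x} → E G u a v b → Walk v w x → Walk u ((a , b) ∷ w) x

  Reach : Word P → V G → Set
  Reach = Walk (pt G)

  DistLe : ℕ → V G → Set
  DistLe n v = ∃ λ w → length w ≤ n × Reach w v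

  InDisk : ℕ → V G → Set
  InDisk r = DistLe (suc r)

  repoint : V G → Graph L D P
  repoint u = record G { pt = u }

  -- disk G^r: subgraph induced by vertices at distance ≤ r+1, labels kept
  -- only on vertices at distance ≤ r and edges between such vertices.
  -- (Vertices outside the disk are unreachable, hence invisible modulo.)
  disk : ℕ → Graph L D P
  disk r = record
    { V       = V G
    ; E       = λ u a v b → E G u a v b × InDisk r u × InDisk r v
    ; pt      = pt G
    ; HasLab  = λ v l → DistLe r v × HasLab G v l
    ; HasELab = λ v a d → HasELab G v a d × DistLe r v
                          × ∃₂ λ x b → E G v a x b × DistLe r x
    }

  record IsGraph : Set where
    field
      E-sym     : ∀ {u a v b} → E G u a v b → E G v b u a
      E-fun     : ∀ {u a v b v' b'} → E G u a v b → E G u a v' b' → v ≡ v' × b ≡ b'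
      lab-fun   : ∀ {v l l'} → HasLab G v l → HasLab G v l' → l ≡ l'
      elab-fun  : ∀ {v a d d'} → HasELab G v a d → HasELab G v a d' → d ≡ d'
      elab-edge : ∀ {u a d} → HasELab G u a d → ∃₂ λ v b → E G u a v b
      elab-sym  : ∀ {u a v b d} → E G u a v b → HasELab G u a d → HasELab G v b d
      connected : ∀ v → ∃ λ w → Reach w v

-- Equality of pointed graphs modulo (pointed isomorphism), expressed
-- through paths: same paths, same identifications, same labels.
record _≅_ {L D P : Set} (G H : Graph L D P) : Set where
  field
    same : ∀ w w' → (∃ λ v → Reach G w v × Reach G w' v)
                  ⇔ (∃ λ v → Reach H w v × Reach H w' v)
    lab  : ∀ {w v v'} l → Reach G w v → Reach H w v' → HasLab G v l ⇔ HasLab H v' l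
    elab : ∀ {w v v'} a d → Reach G w v → Reach H w v' → HasELab G v a d ⇔ HasELab H v' a d

Corr : {L D P : Set} (G H : Graph L D P) → V G → V H → Set
Corr G H x y = ∃ λ q → Reach G q x × Reach H q y

-- Dynamics over a set S of pointed graphs modulo.
-- F and R are required to be compatible with _≅_ (they act on classes;
-- R acts on vertices designated by paths).

record Dynamics {L D P : Set} (S : Graph L D P → Set₁) : Set₁ where
  field
    F      : (G : Graph L D P) → S G → Graph L D P
    F-in   : ∀ G (s : S G) → S (F G s)
    R      : ∀ G (s : S G) → V G → V (F G s)
    F-cong : ∀ {G H} (s : S G) (t : S H) → G ≅ H → F G s ≅ F H t
    R-cong : ∀ {G H} (s : S G) (t : S H) → G ≅ H →
             ∀ {w x y} → Reach G w x → Reach H w y →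
             Corr (F G s) (F H t) (R G s x) (R H t y)

module _ {L D P : Set} {S : Graph L D P → Set₁} (Dy : Dynamics S) where
  open Dynamics Dy

  Continuous : Set₁
  Continuous = ∀ G (s : S G) (m : ℕ) → ∃ λ n → ∀ H (t : S H) → disk G n ≅ disk H n →
      (disk (F G s) m ≅ disk (F H t) m)
    × (∀ x → InDisk (F G s) m (R G s x) → InDisk G n x)
    × (∀ y → InDisk (F H t) m (R H t y) → InDisk H n y)
    × (∀ {w x y} → Reach (disk G n) w x → Reach (disk H n) w y →
         InDisk (F G s) m (R G s x) ⊎ InDisk (F H t) m (R H t y) →
         Corr (disk (F G s) m) (disk (F H t) m) (R G s x) (R H t y))

  ShiftInvariant : Set₁
  ShiftInvariant = ∀ G (s : S G) (u : V G) (t : S (repoint G u)) →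
      (F (repoint G u) t ≅ repoint (F G s) (R G s u))
    × (∀ x q → Reach (F (repoint G u) t) q (R (repoint G u) t x) →
               Walk (F G s) (R G s u) q (R G s x))

  Bounded : Set₁
  Bounded = ∃ λ b → ∀ G (s : S G) (y : V (F G s)) →
      ∃ λ x → InDisk (repoint (F G s) (R G s x)) b y

  IsCGD : Set₁
  IsCGD = Continuous × ShiftInvariant × Bounded

  VertexPreserving : Set₁
  VertexPreserving = ∀ G (s : S G) → Bijective _≡_ _≡_ (R G s)

data Extra : Set where
  pm pl pr : Extra

dir : Bool → Extra
dir false = pl
dir true  = pr

module _ {L D P : Set} (X : Graph L D P) where

  AV : Set
  AV = V X ⊎ (V X × List Bool)   -- original vertex, or tree node (root = [])

  data AE : AV → P ⊎ Extra → AV → P ⊎ Extra → Set where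
    orig     : ∀ {u a v b} → E X u a v b → AE (inj₁ u) (inj₁ a) (inj₁ v) (inj₁ b)
    up       : ∀ {u} → AE (inj₁ u) (inj₂ pm) (inj₂ (u , [])) (inj₂ pm)
    down     : ∀ {u} → AE (inj₂ (u , [])) (inj₂ pm) (inj₁ u) (inj₂ pm)
    toChild  : ∀ {u p} d → AE (inj₂ (u , p)) (inj₂ (dir d)) (inj₂ (u , d ∷ p)) (inj₂ pm)
    toParent : ∀ {u p} d → AE (inj₂ (u , d ∷ p)) (inj₂ pm) (inj₂ (u , p)) (inj₂ (dir d))

  data ALab : AV → L ⊎ ⊤ → Set where
    origL : ∀ {v l} → HasLab X v l → ALab (inj₁ v) (inj₁ l)
    treeL : ∀ {x} → ALab (inj₂ x) (inj₂ tt)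

  data AELab : AV → P ⊎ Extra → D → Set where
    origE : ∀ {v a d} → HasELab X v a d → AELab (inj₁ v) (inj₁ a) d

  Attach : Graph (L ⊎ ⊤) D (P ⊎ Extra)
  Attach = record { V = AV ; E = AE ; pt = inj₁ (pt X) ; HasLab = ALab ; HasELab = AELab }

treeWord : {P : Set} → List Bool → Word (P ⊎ Extra)
treeWord = map (λ d → (inj₂ (dir d) , inj₂ pm))

mmStep : {P : Set} → (P ⊎ Extra) × (P ⊎ Extra)
mmStep = (inj₂ pm , inj₂ pm)

YSet : {L D P : Set} → Graph (L ⊎ ⊤) D (P ⊎ Extra) → Set₁
YSet {L} {D} {P} G = IsGraph G × ∃ λ (X : Graph L D P) → IsGraph X ×
                     ∃ λ (u : AV X) → G ≅ repoint (Attach X) u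

YBar : {L D P : Set} → Graph (L ⊎ ⊤) D (P ⊎ Extra) → Set₁
YBar G = IsGraph G × ∀ r → ∃ λ Y → YSet Y × disk Y r ≅ disk G r

IMQuiescent : {L D P : Set} {S : Graph (L ⊎ ⊤) D (P ⊎ Extra) → Set₁} → Dynamics S → Set₁
IMQuiescent {L} {D} {P} {S} Dy = ∃ λ b →
  ∀ (X : Graph L D P) → IsGraph X → ∀ (s t : List Bool) → b ≤ length s →
  ∀ y → Reach (Attach X) (mmStep ∷ treeWord s) y →
  ∀ (sy : S (repoint (Attach X) y)) →
  ∀ x → Walk (Attach X) y (treeWord t) x →
  Reach (F (repoint (Attach X) y) sy) (treeWord t) (R (repoint (Attach X) y) sy x)
  where open Dynamics Dy

Extends : {L D P : Set} → Dynamics (YBar {L} {D} {P}) → Dynamics (YSet {L} {D} {P}) → Set₁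
Extends D' Dy = ∀ G (y : YSet G) (yb : YBar G) →
    (Dynamics.F D' G yb ≅ Dynamics.F Dy G y)
  × (∀ {w x} → Reach G w x →
       Corr (Dynamics.F D' G yb) (Dynamics.F Dy G y) (Dynamics.R D' G yb x) (Dynamics.R Dy G y x))

IsIMCGD : {s d p : ℕ} → Dynamics (YSet {Fin s} {Fin d} {Fin p}) → Set₁
IsIMCGD Dy = IsCGD Dy × VertexPreserving Dy × IMQuiescent Dy

{-# OPTIONS --safe #-}
module Submission where

-- The closure only adds graphs made of invisible matter alone, on which the extension is the
-- identity.  Deep in the invisible matter, quiescence and shift-invariance force R to preserve
-- the tree edges, and since the image again lies in YSet, whose tree vertices have no other edges
-- or labels, F is locally the identity there.  In a graph of the closure every vertex v either
-- is deep or has a real vertex at bounded distance; in the latter case the whole graph lies in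
-- YSet, because its original graph can be read off from the vertices not labelled m.  So the
-- image can keep the vertices of the argument (R = id) and take the edges at v from F or from
-- the argument according to this local alternative.  A bound on the depth of the pointer also
-- gives continuity: it is determined by a disk, and either puts all nearby graphs in YSet or makes
-- F act as the identity on the disk.

open import Defs
open import Data.Nat using (ℕ; zero; suc; _+_; _≤_; z≤n; s≤s; _≤?_)
open import Data.Nat.Properties using (≤-trans; ≤-refl; +-comm; +-assoc; +-suc; +-mono-≤; +-monoʳ-≤; m≤m+n; m≤n+m; n≤1+n; 1+n≰n; ≰⇒>)
open import Data.Bool using (Bool; true; false; T)
open import Data.Bool.Properties using (T-irrelevant)
open import Data.List using (List; []; _∷_; length; _++_; reverse; _ʳ++_)
open import Data.List.Properties using (length-++; reverse-involutive; length-reverse)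
open import Data.Product using (Σ; ∃; ∃₂; _×_; _,_; proj₁; proj₂; -,_)
import Data.Sum as Sum
open import Data.Sum using (_⊎_; inj₁; inj₂)
open import Data.Sum.Properties using (inj₁-injective)
open import Data.Empty using (⊥-elim)
open import Data.Unit using (⊤; tt)
open import Data.Fin using (Fin)
open import Function using (_⇔_; mk⇔; flip; id; _∘_; Equivalence)
open import Function.Properties.Equivalence using (⇔-isEquivalence)
open import Relation.Binary.Structures using (IsEquivalence)
open import Relation.Nullary using (¬_; yes; no)
open import Relation.Binary.PropositionalEquality using (_≡_; refl; sym; trans; cong; subst)
open Equivalence using (to; from)

private variable
  L D P : Set
  G H K : Graph L D P
  j k m n : ℕ
  w w' : Word P

-- Walks

-- A disk is in general no `IsGraph`: vertices outside it stay in the carrier but are unreachable.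
-- Symmetry and uniqueness of edges survive, and they suffice for reasoning along paths.
record Deterministic (G : Graph L D P) : Set where
  field
    edge-sym    : ∀ {u a v b} → E G u a v b → E G v b u a
    edge-unique : ∀ {u a v b v' b'} → E G u a v b → E G u a v' b' → v ≡ v' × b ≡ b'
open Deterministic

graph-det : IsGraph G → Deterministic G
graph-det g = record { edge-sym = IsGraph.E-sym g ; edge-unique = IsGraph.E-fun g }

disk-det : ∀ n → Deterministic G → Deterministic (disk G n)
disk-det n d = record
  { edge-sym    = λ (e , i , j) → edge-sym d e , j , i
  ; edge-unique = λ (e , _) (e' , _) → edge-unique d e e' }

_⊕_ : ∀ {u v x} → Walk G u w v → Walk G v w' x → Walk G u (w ++ w') x
[]       ⊕ q = q
step e p ⊕ q = step e (p ⊕ q)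

walk-split : ∀ w {u x} → Walk G u (w ++ w') x → ∃ λ v → Walk G u w v × Walk G v w' x
walk-split []      p = -, [] , p
walk-split (_ ∷ w) (step e p) with _ , p₁ , p₂ ← walk-split w p = -, step e p₁ , p₂

walk-det : Deterministic G → ∀ {u x y} → Walk G u w x → Walk G u w y → x ≡ y
walk-det d []         []          = refl
walk-det d (step e p) (step e' p') with refl , _ ← edge-unique d e e' = walk-det d p p'

walk-codet : Deterministic G → ∀ {u v x} → Walk G u w x → Walk G v w x → u ≡ v
walk-codet d []         []          = refl
walk-codet d (step e p) (step e' p') with refl ← walk-codet d p p' =
  proj₁ (edge-unique d (edge-sym d e) (edge-sym d e'))

walk-reverse : Deterministic G → ∀ {u x} → Walk G u w x →
               ∃ λ w' → length w' ≡ length w × Walk G x w' u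
walk-reverse d [] = [] , refl , []
walk-reverse d (step {a = a} {b = b} e p) with w' , l , p' ← walk-reverse d p =
  w' ++ (b , a) ∷ [] ,
  trans (length-++ w') (trans (+-comm (length w') 1) (cong suc l)) ,
  p' ⊕ step (edge-sym d e) []

walk-map : (f : V G → V H) → (∀ {u a v b} → E G u a v b → E H (f u) a (f v) b) →
           ∀ {u x} → Walk G u w x → Walk H (f u) w (f x)
walk-map f h []         = []
walk-map f h (step e p) = step (h e) (walk-map f h p)

walk-repoint : ∀ {u x y} → Walk G x w y → Walk (repoint G u) x w y
walk-repoint = walk-map id id

walk-unrepoint : ∀ {u x y} → Walk (repoint G u) x w y → Walk G x w y
walk-unrepoint = walk-map id id

walk-undisk : ∀ {x y} → Walk (disk G n) x w y → Walk G x w y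
walk-undisk = walk-map id proj₁

repoint-graph : IsGraph G → ∀ u → IsGraph (repoint G u)
repoint-graph {G = G} g u = record
  { IsGraph g hiding (connected)
  ; connected = λ v →
      let _ , p = IsGraph.connected g u
          _ , q = IsGraph.connected g v
          _ , _ , p' = walk-reverse (graph-det g) p
      in -, walk-repoint (p' ⊕ q) }

DistLe-mono : j ≤ k → ∀ {x} → DistLe G j x → DistLe G k x
DistLe-mono j≤k (w , l , p) = w , ≤-trans l j≤k , p

DistLe-trans : ∀ {x y} → DistLe G j x → DistLe (repoint G x) k y → DistLe G (j + k) y
DistLe-trans (w , l , p) (w' , l' , p') =
  w ++ w' , subst (_≤ _) (sym (length-++ w)) (+-mono-≤ l l') , p ⊕ walk-unrepoint p'

DistLe-edge : ∀ {x y a b} → E G x a y b → DistLe (repoint G x) 1 y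
DistLe-edge e = -, ≤-refl , step e []

-- Every vertex visited is within `j` plus the length of the walk from the pointer, so the bound
-- `suc n` of `InDisk` is never exceeded.
walk-disk : ∀ {x y} → DistLe G j x → j + length w ≤ suc n → Walk G x w y → Walk (disk G n) x w y
walk-disk dx l [] = []
walk-disk {G = G} {j = j} {w = _ ∷ w} {n = n} dx l (step {v = v} e p) =
  step (e , DistLe-mono (≤-trans (m≤m+n j _) l) dx , DistLe-mono (≤-trans (m≤m+n (j + 1) _) l') dv)
       (walk-disk dv l' p)
  where
  dv : DistLe G (j + 1) v
  dv = DistLe-trans dx (DistLe-edge {G = G} e)
  l' : j + 1 + length w ≤ suc n
  l' = subst (_≤ suc n) (sym (+-assoc j 1 (length w))) l

reach-disk : ∀ {x} → length w ≤ suc n → Reach G w x → Reach (disk G n) w x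
reach-disk = walk-disk ([] , z≤n , [])

-- Equality modulo as bisimulation

module ⇔ {ℓ} = IsEquivalence (⇔-isEquivalence {ℓ})

-- `C` is a relation because vertices are matched through paths, and unreachable ones may lack a
-- partner. Injectivity is `func` of the converse simulation.
record Sim (G H : Graph L D P) (C : V G → V H → Set) : Set where
  field
    point : C (pt G) (pt H)
    edge  : ∀ {x y x' a b} → C x y → E G x a x' b → ∃ λ y' → E H y a y' b × C x' y'
    func  : ∀ {x y y'} → C x y → C x y' → y ≡ y'
    lab   : ∀ {x y l} → C x y → HasLab G x l → HasLab H y l
    elab  : ∀ {x y a d} → C x y → HasELab G x a d → HasELab H y a d
open Sim

Bisim : (G H : Graph L D P) (C : V G → V H → Set) → Set
Bisim G H C = Sim G H C × Sim H G (flip C)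

sim-walk : ∀ {C x y x'} → Sim G H C → C x y → Walk G x w x' → ∃ λ y' → Walk H y w y' × C x' y'
sim-walk s c []         = -, [] , c
sim-walk s c (step e p) with _ , e' , c' ← edge s c e with _ , p' , c'' ← sim-walk s c' p =
  -, step e' p' , c''

sim-dist : ∀ {C x y} → Sim G H C → C x y → DistLe G k x → DistLe H k y
sim-dist s c (w , l , p) with _ , p' , c' ← sim-walk s (point s) p with refl ← func s c c' = w , l , p'

-- Paths transport along the relation and `func` preserves coincidence of endpoints. Determinism of
-- `H` identifies the transported endpoint with any given one, so that labels can be compared.
bisim⇒≅ : ∀ {C} → Deterministic H → Bisim G H C → G ≅ H
bisim⇒≅ {H = H} {G = G} {C = C} d (s , s') = record
  { same = λ w w' → mk⇔
      (λ (_ , p , q) → common s p q)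
      (λ (_ , p , q) → common s' p q)
  ; lab  = λ l p q → let c = related p q in mk⇔ (lab s c) (lab s' c)
  ; elab = λ a l p q → let c = related p q in mk⇔ (elab s c) (elab s' c) }
  where
  related : ∀ {w x y} → Reach G w x → Reach H w y → C x y
  related p q with _ , q' , c ← sim-walk s (point s) p with refl ← walk-det d q q' = c
  common : ∀ {A B : Graph _ _ _} {R : V A → V B → Set} → Sim A B R → ∀ {w w' v} →
           Reach A w v → Reach A w' v → ∃ λ v' → Reach B w v' × Reach B w' v'
  common s p q with _ , p' , c ← sim-walk s (point s) p
               with _ , q' , c' ← sim-walk s (point s) q with refl ← func s c c' = -, p' , q'

≅-sym : G ≅ H → H ≅ G
≅-sym i = record
  { same = λ w w' → ⇔.sym (_≅_.same i w w')
  ; lab  = λ l p q → ⇔.sym (_≅_.lab i l q p)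
  ; elab = λ a l p q → ⇔.sym (_≅_.elab i a l q p) }

≅-refl : Deterministic G → G ≅ G
≅-refl {G = G} d = bisim⇒≅ {C = _≡_} d (s , s')
  where
  s : Sim G G _≡_
  s = record { point = refl ; edge = λ { refl e → -, e , refl } ; func = λ { refl refl → refl }
             ; lab = λ { refl l → l } ; elab = λ { refl l → l } }
  s' : Sim G G (flip _≡_)
  s' = record { point = refl ; edge = λ { refl e → -, e , refl } ; func = λ { refl refl → refl }
              ; lab = λ { refl l → l } ; elab = λ { refl l → l } }

≅-reach : G ≅ H → ∀ {x} → Reach G w x → ∃ λ y → Reach H w y
≅-reach {w = w} i p with y , q , _ ← to (_≅_.same i w w) (-, p , p) = y , q

≅-trans : G ≅ H → H ≅ K → G ≅ K
≅-trans i j = record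
  { same = λ w w' → ⇔.trans (_≅_.same i w w') (_≅_.same j w w')
  ; lab  = λ l p q → let _ , r = ≅-reach i p in ⇔.trans (_≅_.lab i l p r) (_≅_.lab j l r q)
  ; elab = λ a l p q → let _ , r = ≅-reach i p in ⇔.trans (_≅_.elab i a l p r) (_≅_.elab j a l r q) }

corr-sym : ∀ {x y} → Corr G H x y → Corr H G y x
corr-sym (q , p , p') = q , p' , p

-- `Corr` is functional because two paths to one vertex are identified on both sides. An edge is
-- matched by appending it to a path, transporting the longer path and splitting off the last step.
≅⇒sim : Deterministic G → Deterministic H → G ≅ H → Sim G H (Corr G H)
≅⇒sim {G = G} {H = H} dG dH i = record
  { point = [] , [] , []
  ; edge  = edge'
  ; func  = λ {x} {y} {y'} (q , p , r) (q' , p' , r') →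
      let _ , s , s' = to (_≅_.same i q q') (x , p , p')
      in trans (walk-det dH r s) (walk-det dH s' r')
  ; lab   = λ (q , p , r) → to (_≅_.lab i _ p r)
  ; elab  = λ (q , p , r) → to (_≅_.elab i _ _ p r) }
  where
  edge' : ∀ {x y x' a b} → Corr G H x y → E G x a x' b → ∃ λ y' → E H y a y' b × Corr G H x' y'
  edge' (q , p , r) e with _ , s ← ≅-reach i (p ⊕ step e []) with walk-split q s
  ... | _ , s₁ , step e' [] with refl ← walk-det dH r s₁ = -, e' , -, p ⊕ step e [] , s

≅⇒bisim : Deterministic G → Deterministic H → G ≅ H → Bisim G H (Corr G H)
≅⇒bisim {G = G} {H = H} dG dH i = ≅⇒sim dG dH i , record
  { point = [] , [] , []
  ; edge  = λ c e → let y , e' , c' = edge s (corr-sym {G = G} {H = H} c) e in y , e' , corr-sym {G = H} {H = G} c'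
  ; func  = λ c c' → func s (corr-sym {G = G} {H = H} c) (corr-sym {G = G} {H = H} c')
  ; lab   = λ c → lab s (corr-sym {G = G} {H = H} c)
  ; elab  = λ c → elab s (corr-sym {G = G} {H = H} c) }
  where s = ≅⇒sim dH dG (≅-sym i)

bisim-repoint : ∀ {C x y} → Bisim G H C → C x y → Bisim (repoint G x) (repoint H y) C
bisim-repoint (s , s') c = record { Sim s hiding (point) ; point = c }
                         , record { Sim s' hiding (point) ; point = c }

-- Disks

sim-disk : ∀ {C} n → Sim G H C → Sim (disk G n) (disk H n) C
sim-disk n s = record
  { point = point s
  ; edge  = λ { c (e , i , i') → let _ , e' , c' = edge s c e in -, (e' , sim-dist s c i , sim-dist s c' i') , c' }
  ; func  = func s
  ; lab   = λ { c (i , l) → sim-dist s c i , lab s c l }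
  ; elab  = λ { c (l , i , _ , _ , e , i') →
      let _ , e' , c' = edge s c e in elab s c l , sim-dist s c i , -, -, e' , sim-dist s c' i' } }

bisim-disk : ∀ {C} n → Bisim G H C → Bisim (disk G n) (disk H n) C
bisim-disk n (s , s') = sim-disk n s , sim-disk n s'

≅-disk : IsGraph G → IsGraph H → ∀ n → G ≅ H → disk G n ≅ disk H n
≅-disk g h n i = bisim⇒≅ (disk-det n (graph-det h)) (bisim-disk n (≅⇒bisim (graph-det g) (graph-det h) i))

sim-dist-from : ∀ {C v v' x y} → Sim (disk G n) (disk H n) C → C v v' → DistLe G j v → j + k ≤ suc n →
                DistLe (repoint G v) k x → C x y → DistLe (repoint H v') k y
sim-dist-from {j = j} s c dv l (w , l' , p) cx
  with _ , p' , c' ← sim-walk s c (walk-disk dv (≤-trans (+-monoʳ-≤ j l') l) (walk-unrepoint p))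
  with refl ← func s cx c' = w , l' , walk-repoint (walk-undisk p')

sim-dist-disk : ∀ {C x y} → Sim (disk G n) (disk H n) C → k ≤ suc n → DistLe G k x → C x y → DistLe H k y
sim-dist-disk {G = G} {H = H} s l d c = sim-dist-from {G = G} {H = H} s (point s) ([] , ≤-refl , []) l d c

-- Around a vertex at distance `j`, the disk of radius `m` lies in the disk of radius `j + m` around
-- the pointer, and short walks from the new centre stay inside the big disk.
sim-disk-shift : ∀ {C v v'} → Sim (disk G n) (disk H n) C → C v v' → DistLe G j v → j + m ≤ n →
                 Sim (disk (repoint G v) m) (disk (repoint H v') m) C
sim-disk-shift {G = G} {n = n} {H = H} {j = j} {m = m} {v = v} {v' = v'} s c dv l = record
  { point = c
  ; edge  = λ { cx (e , i , i') → let _ , (e' , _) , cx' = edge s cx (e , wide i , wide i')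
                                  in -, (e' , near i cx , near i' cx') , cx' }
  ; func  = func s
  ; lab   = λ { cx (i , h) → near' i cx , proj₂ (lab s cx (wide' i , h)) }
  ; elab  = λ { cx (h , i , _ , _ , e , i') →
      let h' , _ = elab s cx (h , wide' i , -, -, e , wide' i')
          _ , (e' , _) , cx' = edge s cx (e , DistLe-mono (n≤1+n n) (wide' i) , DistLe-mono (n≤1+n n) (wide' i'))
      in h' , near' i cx , -, -, e' , near' i' cx' } }
  where
  l' : j + suc m ≤ suc n
  l' = subst (_≤ suc n) (sym (+-suc j m)) (s≤s l)
  -- Edges reach distance `suc m` but labels only `m`, hence two versions of each bound.
  wide : ∀ {x} → InDisk (repoint G v) m x → InDisk G n x
  wide i = DistLe-mono l' (DistLe-trans dv i)
  wide' : ∀ {x} → DistLe (repoint G v) m x → DistLe G n x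
  wide' i = DistLe-mono l (DistLe-trans dv i)
  near : ∀ {x y} → InDisk (repoint G v) m x → _ → InDisk (repoint H v') m y
  near = sim-dist-from {G = G} {H = H} s c dv l'
  near' : ∀ {x y} → DistLe (repoint G v) m x → _ → DistLe (repoint H v') m y
  near' = sim-dist-from {G = G} {H = H} s c dv (≤-trans l (n≤1+n n))

bisim-disk-shift : ∀ {C v v'} → Bisim (disk G n) (disk H n) C → C v v' → DistLe G j v → j + m ≤ n →
                   Bisim (disk (repoint G v) m) (disk (repoint H v') m) C
bisim-disk-shift {G = G} {n = n} {H = H} {j = j} {m = m} (s , s') c dv l =
  sim-disk-shift {G = G} {H = H} s c dv l ,
  sim-disk-shift {G = H} {H = G} s' c
    (sim-dist-disk {G = G} {H = H} s (≤-trans (≤-trans (m≤m+n j m) l) (n≤1+n n)) dv c) l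

≅-disk-shrink : IsGraph G → IsGraph H → m ≤ n → disk G n ≅ disk H n → disk G m ≅ disk H m
≅-disk-shrink {G = G} {H = H} {n = n} g h m≤n i = bisim⇒≅ (disk-det _ (graph-det h))
  (bisim-disk-shift {G = G} {H = H} {j = 0}
    (≅⇒bisim (disk-det n (graph-det g)) (disk-det n (graph-det h)) i) ([] , [] , []) ([] , z≤n , []) m≤n)

-- Local structure of graphs with invisible matter

PortedGraph : (L D P : Set) → Set₁
PortedGraph L D P = Graph (L ⊎ ⊤) D (P ⊎ Extra)

Tree : (G : PortedGraph L D P) → V G → Set
Tree G v = HasLab G v (inj₂ tt)

-- Only the ports and the label of the target are recorded, so the kind of a vertex can be read off
-- a disk of radius 1.
data TreeEdge (G : PortedGraph L D P) : P ⊎ Extra → V G → P ⊎ Extra → Set where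
  child  : ∀ {v} d → Tree G v → TreeEdge G (inj₂ (dir d)) v (inj₂ pm)
  parent : ∀ {v} d → Tree G v → TreeEdge G (inj₂ pm) v (inj₂ (dir d))
  root   : ∀ {v} → ¬ Tree G v → TreeEdge G (inj₂ pm) v (inj₂ pm)

data RealEdge (G : PortedGraph L D P) : P ⊎ Extra → V G → P ⊎ Extra → Set where
  orig : ∀ {v a b} → ¬ Tree G v → RealEdge G (inj₁ a) v (inj₁ b)
  up   : ∀ {v} → Tree G v → RealEdge G (inj₂ pm) v (inj₂ pm)

record IsTree (G : PortedGraph L D P) (v : V G) : Set where
  field
    label    : Tree G v
    no-elab  : ∀ {a d} → ¬ HasELab G v a d
    children : ∀ d → ∃ λ v' → E G v (inj₂ (dir d)) v' (inj₂ pm)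
    edges    : ∀ {a v' b} → E G v a v' b → TreeEdge G a v' b

record IsReal (G : PortedGraph L D P) (v : V G) : Set where
  field
    no-label : ¬ Tree G v
    root-of  : ∃ λ v' → E G v (inj₂ pm) v' (inj₂ pm)
    edges    : ∀ {a v' b} → E G v a v' b → RealEdge G a v' b

Kind : (G : PortedGraph L D P) → V G → Set
Kind G v = IsTree G v ⊎ IsReal G v

pm≢dir : ∀ d → ¬ inj₂ {A = P} pm ≡ inj₂ (dir d)
pm≢dir false ()
pm≢dir true  ()

-- Graphs with attached trees

attach-kind : (X : Graph L D P) (y : AV X) → Kind (Attach X) y
attach-kind X (inj₁ x) = inj₂ (record
  { no-label = λ ()
  ; root-of  = -, up
  ; edges    = λ { (orig _) → orig (λ ()) ; up → up treeL } })
attach-kind X (inj₂ x) = inj₁ (record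
  { label    = treeL
  ; no-elab  = λ ()
  ; children = λ d → -, toChild d
  ; edges    = λ { down → root (λ ()) ; (toChild d) → child d treeL ; (toParent d) → parent d treeL } })

attach-graph : {X : Graph L D P} → IsGraph X → IsGraph (Attach X)
attach-graph {X = X} g = record
  { E-sym     = attach-sym
  ; E-fun     = attach-fun
  ; lab-fun   = λ { (origL l) (origL l') → cong inj₁ (lab-fun l l') ; treeL treeL → refl }
  ; elab-fun  = λ { (origE d) (origE d') → elab-fun d d' }
  ; elab-edge = λ { (origE d) → let _ , _ , e = elab-edge d in -, -, orig e }
  ; elab-sym  = λ { (orig e) (origE d) → origE (elab-sym e d) }
  ; connected = conn }
  where
  open IsGraph g
  attach-sym : ∀ {u a v b} → AE X u a v b → AE X v b u a
  attach-sym (orig e)     = orig (E-sym e)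
  attach-sym up           = down
  attach-sym down         = up
  attach-sym (toChild d)  = toParent d
  attach-sym (toParent d) = toChild d
  -- The ports are compared by an equation because unification cannot invert dir.
  fun' : ∀ {u a v b a' v' b'} → AE X u a v b → AE X u a' v' b' → a ≡ a' → v ≡ v' × b ≡ b'
  fun' (orig e)     (orig e')     refl with refl , refl ← E-fun e e' = refl , refl
  fun' up           up            _ = refl , refl
  fun' down         down          _ = refl , refl
  fun' down         (toChild d) q = ⊥-elim (pm≢dir d q)
  fun' (toChild d)  down        q = ⊥-elim (pm≢dir d (sym q))
  fun' (toChild false) (toChild false) _ = refl , refl
  fun' (toChild true)  (toChild true)  _ = refl , refl
  fun' (toChild false) (toChild true)  ()
  fun' (toChild true)  (toChild false) ()
  fun' (toChild d)  (toParent _) q = ⊥-elim (pm≢dir d (sym q))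
  fun' (toParent _) (toChild d)  q = ⊥-elim (pm≢dir d q)
  fun' (toParent d) (toParent .d)      _ = refl , refl
  attach-fun : ∀ {u a v b v' b'} → AE X u a v b → AE X u a v' b' → v ≡ v' × b ≡ b'
  attach-fun e e' = fun' e e' refl
  lift : ∀ {x w y} → Walk X x w y → ∃ λ w' → Walk (Attach X) (inj₁ x) w' (inj₁ y)
  lift []         = -, []
  lift (step e p) = -, step (orig e) (proj₂ (lift p))
  conn : ∀ v → ∃ λ w → Reach (Attach X) w v
  conn (inj₁ x)           = lift (proj₂ (connected x))
  conn (inj₂ (x , []))    = -, proj₂ (conn (inj₁ x)) ⊕ step up []
  conn (inj₂ (x , d ∷ p)) = -, proj₂ (conn (inj₂ (x , p))) ⊕ step (toChild d) []

-- Quiescence speaks only of the tree at the pointer of the original graph; this moves that pointer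
-- elsewhere. The two edge relations are distinct inductive families, hence the translation by
-- constructors.
attach-repoint : {X : Graph L D P} → IsGraph X → ∀ x y →
                 repoint (Attach (repoint X x)) y ≅ repoint (Attach X) y
attach-repoint {X = X} g x y = bisim⇒≅ {C = _≡_} (graph-det (repoint-graph (attach-graph g) y)) (s , s')
  where
  E⇒ : ∀ {u a v b} → AE (repoint X x) u a v b → AE X u a v b
  E⇒ (orig e)     = orig e
  E⇒ up           = up
  E⇒ down         = down
  E⇒ (toChild d)  = toChild d
  E⇒ (toParent d) = toParent d
  E⇐ : ∀ {u a v b} → AE X u a v b → AE (repoint X x) u a v b
  E⇐ (orig e)     = orig e
  E⇐ up           = up
  E⇐ down         = down
  E⇐ (toChild d)  = toChild d
  E⇐ (toParent d) = toParent d
  s : Sim (repoint (Attach (repoint X x)) y) (repoint (Attach X) y) _≡_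
  s = record { point = refl ; edge = λ { refl e → -, E⇒ e , refl } ; func = λ { refl refl → refl }
             ; lab = λ { refl (origL l) → origL l ; refl treeL → treeL } ; elab = λ { refl (origE l) → origE l } }
  s' : Sim (repoint (Attach X) y) (repoint (Attach (repoint X x)) y) (flip _≡_)
  s' = record { point = refl ; edge = λ { refl e → -, E⇐ e , refl } ; func = λ { refl refl → refl }
              ; lab = λ { refl (origL l) → origL l ; refl treeL → treeL } ; elab = λ { refl (origE l) → origE l } }

-- Depth in the invisible matter, as the number of ancestors reached by tree edges.
Deep : (G : PortedGraph L D P) → ℕ → V G → Set
Deep G zero    v = ⊤
Deep G (suc k) v = ∃₂ λ d z → E G v (inj₂ pm) z (inj₂ (dir d)) × Deep G k z

deep-mono : {G : PortedGraph L D P} → ∀ {v} → j ≤ k → Deep G k v → Deep G j v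
deep-mono z≤n     _               = tt
deep-mono (s≤s l) (d , z , e , h) = d , z , e , deep-mono l h

depth : {X : Graph L D P} → AV X → ℕ
depth (inj₁ _)       = 0
depth (inj₂ (_ , p)) = length p

-- Only `toParent` leaves by `pm` and arrives by a child port, so original vertices and roots have
-- no ancestor in the sense of `Deep`.
attach-parent : ∀ {X : Graph L D P} {y a z c d} → AE X y a z c → a ≡ inj₂ pm → c ≡ inj₂ (dir d) →
                ∃₂ λ x p → y ≡ inj₂ (x , d ∷ p) × z ≡ inj₂ (x , p)
attach-parent {d = d} up   _ q = ⊥-elim (pm≢dir d q)
attach-parent {d = d} down _ q = ⊥-elim (pm≢dir d q)
attach-parent (toChild d') q _ = ⊥-elim (pm≢dir d' (sym q))
attach-parent {d = false} (toParent false) _ _ = -, -, refl , refl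
attach-parent {d = false} (toParent true)  _ ()
attach-parent {d = true}  (toParent false) _ ()
attach-parent {d = true}  (toParent true)  _ _ = -, -, refl , refl

attach-deep : {X : Graph L D P} → ∀ {y} → Deep (Attach X) k y → k ≤ depth {X = X} y
attach-deep {k = zero}  _ = z≤n
attach-deep {k = suc k} (d , z , e , h) with _ , _ , refl , refl ← attach-parent e refl refl = s≤s (attach-deep h)

depth-deep : {X : Graph L D P} (y : AV X) → k ≤ depth {X = X} y → Deep (Attach X) k y
depth-deep {k = zero}  y                  l       = tt
depth-deep {k = suc k} (inj₂ (x , d ∷ p)) (s≤s l) = d , -, toParent d , depth-deep (inj₂ (x , p)) l

sim-deep : {G H : PortedGraph L D P} → ∀ {C x y} → Sim G H C → C x y → Deep G k x → Deep H k y
sim-deep {k = zero}  s c h = tt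
sim-deep {k = suc k} s c (d , z , e , h) with _ , e' , c' ← edge s c e = d , -, e' , sim-deep s c' h

deep-disk : {G : PortedGraph L D P} → ∀ {x} → DistLe G j x → j + k ≤ suc n → Deep G k x → Deep (disk G n) k x
deep-disk {k = zero} i l h = tt
deep-disk {j = j} {k = suc k} {n = n} {G = G} i l (d , z , e , h) =
  d , z , (e , DistLe-mono (≤-trans (m≤m+n j _) l) i , DistLe-mono (≤-trans (m≤m+n (j + 1) _) l') i') , deep-disk i' l' h
  where
  i' : DistLe G (j + 1) z
  i' = DistLe-trans i (DistLe-edge {G = G} e)
  l' : j + 1 + k ≤ suc n
  l' = subst (_≤ suc n) (sym (+-assoc j 1 k)) l

deep-undisk : {G : PortedGraph L D P} → ∀ {x} → Deep (disk G n) k x → Deep G k x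
deep-undisk {k = zero}  _ = tt
deep-undisk {k = suc k} (d , z , (e , _) , h) = d , z , e , deep-undisk h

≅-disk-deep : {G H : PortedGraph L D P} → IsGraph G → IsGraph H → disk G n ≅ disk H n → k ≤ suc n →
              Deep G k (pt G) → Deep H k (pt H)
≅-disk-deep {G = G} g h i l d = deep-undisk
  (sim-deep s (point s) (deep-disk {G = G} ([] , z≤n , []) l d))
  where s = proj₁ (≅⇒bisim (disk-det _ (graph-det g)) (disk-det _ (graph-det h)) i)

-- The closure of the graphs with invisible matter

YSet-≅ : {G H : PortedGraph L D P} → IsGraph H → G ≅ H → YSet G → YSet H
YSet-≅ h i (_ , X , gX , u , j) = h , X , gX , u , ≅-trans (≅-sym i) j

attach-YSet : {X : Graph L D P} → IsGraph X → ∀ y → YSet (repoint (Attach X) y)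
attach-YSet g y = let r = repoint-graph (attach-graph g) y in r , _ , g , y , ≅-refl (graph-det r)

corr-total : IsGraph G → G ≅ H → ∀ x → ∃ λ y → Corr G H x y
corr-total g i x with w , p ← IsGraph.connected g x with y , q ← ≅-reach i p = y , w , p , q

YSet-repoint : {G : PortedGraph L D P} → YSet G → ∀ v → YSet (repoint G v)
YSet-repoint (g , X , gX , u , i) v =
  let a = repoint-graph (attach-graph gX) u
      v' , c = corr-total g i v
  in repoint-graph g v , X , gX , v' ,
     bisim⇒≅ (graph-det (repoint-graph (attach-graph gX) v'))
       (bisim-repoint (≅⇒bisim (graph-det g) (graph-det a) i) c)

YSet⇒YBar : {G : PortedGraph L D P} → YSet G → YBar G
YSet⇒YBar y = proj₁ y , λ r → _ , y , ≅-refl (disk-det r (graph-det (proj₁ y)))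

YBar-repoint : {G : PortedGraph L D P} → YBar G → ∀ v → YBar (repoint G v)
YBar-repoint {G = G} (g , f) v = repoint-graph g v , λ r →
  let w , p       = IsGraph.connected g v
      -- Moving the pointer along `w` costs `length w` of the radius.
      n           = length w + r
      Y , y , i   = f n
      gY          = proj₁ y
      c           = reach-disk (≤-trans (m≤m+n (length w) r) (n≤1+n n)) p
      v' , c'     = ≅-reach (≅-sym i) c
  in repoint Y v' , YSet-repoint y v' ,
     bisim⇒≅ (disk-det r (graph-det (repoint-graph g v)))
       (bisim-disk-shift {G = Y} {H = G}
         (≅⇒bisim (disk-det n (graph-det gY)) (disk-det n (graph-det g)) i)
         (w , c' , c) (w , ≤-refl , walk-undisk c') ≤-refl)

approx : {G : PortedGraph L D P} → YBar G → ∀ r → ∃ λ (X : Graph L D P) → IsGraph X × ∃ λ u →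
         Bisim (disk (repoint (Attach X) u) r) (disk G r) (Corr (disk (repoint (Attach X) u) r) (disk G r))
approx (g , f) r =
  let Y , (gY , X , gX , u , i) , j = f r
      gA = repoint-graph (attach-graph gX) u
  in X , gX , u , ≅⇒bisim (disk-det r (graph-det gA)) (disk-det r (graph-det g))
                          (≅-trans (≅-sym (≅-disk gY gA r i)) j)

-- Positive facts are pushed forward and negative ones pulled back. At radius 1 the disk still shows
-- the labels of the neighbours.
kind-transfer : {G H : PortedGraph L D P} → IsGraph H → ∀ {C} → Bisim (disk G 1) (disk H 1) C →
                Kind G (pt G) → Kind H (pt H)
kind-transfer {L} {D} {P} {G = G} {H = H} h {C} (s , s') = λ
  { (inj₁ t) → let open IsTree t in inj₁ (record
      { label    = tree⇒ (point s) z∈ label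
      ; no-elab  = λ l → let _ , _ , e = IsGraph.elab-edge h l
                         in no-elab (proj₁ (elab s' (point s) (l , z∈ , -, -, e , s∈ {G = H} e)))
      ; children = λ d → let _ , e = children d ; _ , (e' , _) , _ = edge s (point s) (inD {G = G} e) in -, e'
      ; edges    = λ e → let _ , (e' , _) , c = edge s' (point s) (inD {G = H} e) in treeEdge c (s∈ {G = G} e') (s∈ {G = H} e) (edges e') })
  ; (inj₂ t) → let open IsReal t in inj₂ (record
      { no-label = λ l → no-label (tree⇐ (point s) z∈ l)
      ; root-of  = let _ , e = root-of ; _ , (e' , _) , _ = edge s (point s) (inD {G = G} e) in -, e'
      ; edges    = λ e → let _ , (e' , _) , c = edge s' (point s) (inD {G = H} e) in realEdge c (s∈ {G = G} e') (s∈ {G = H} e) (edges e') }) }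
  where
  z∈ : {G : PortedGraph L D P} → DistLe G k (pt G)
  z∈ = [] , z≤n , []
  s∈ : ∀ {G : PortedGraph L D P} {a v b} → E G (pt G) a v b → DistLe G 1 v
  s∈ {G} e = DistLe-edge {G = G} e
  inD : ∀ {G : PortedGraph L D P} {a v b} → E G (pt G) a v b → E (disk G 1) (pt G) a v b
  inD {G} e = e , z∈ , DistLe-mono (s≤s z≤n) (s∈ {G} e)
  tree⇒ : ∀ {x y} → C x y → DistLe G 1 x → Tree G x → Tree H y
  tree⇒ c i l = proj₂ (lab s c (i , l))
  tree⇐ : ∀ {x y} → C x y → DistLe H 1 y → Tree H y → Tree G x
  tree⇐ c i l = proj₂ (lab s' c (i , l))
  treeEdge : ∀ {a b x y} → C x y → DistLe G 1 x → DistLe H 1 y → TreeEdge G a x b → TreeEdge H a y b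
  treeEdge c i j (child d t)  = child d (tree⇒ c i t)
  treeEdge c i j (parent d t) = parent d (tree⇒ c i t)
  treeEdge c i j (root t)     = root (t ∘ tree⇐ c j)
  realEdge : ∀ {a b x y} → C x y → DistLe G 1 x → DistLe H 1 y → RealEdge G a x b → RealEdge H a y b
  realEdge c i j (orig t) = orig (t ∘ tree⇐ c j)
  realEdge c i j (up t)   = up (tree⇒ c i t)

kind-repoint : {G : PortedGraph L D P} → ∀ u {v} → Kind G v → Kind (repoint G u) v
kind-repoint {G = G} u (inj₁ t) = inj₁ (record { IsTree t hiding (edges) ; edges = go ∘ IsTree.edges t })
  where
  go : ∀ {a v b} → TreeEdge G a v b → TreeEdge (repoint G u) a v b
  go (child d t)  = child d t
  go (parent d t) = parent d t
  go (root t)     = root t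
kind-repoint {G = G} u (inj₂ t) = inj₂ (record { IsReal t hiding (edges) ; edges = go ∘ IsReal.edges t })
  where
  go : ∀ {a v b} → RealEdge G a v b → RealEdge (repoint G u) a v b
  go (orig t) = orig t
  go (up t)   = up t

kind-pt : {G : PortedGraph L D P} → YBar G → Kind G (pt G)
kind-pt y =
  let X , gX , u , b = approx y 1
  in kind-transfer (proj₁ y) b (kind-repoint u (attach-kind X u))

kind : {G : PortedGraph L D P} → YBar G → ∀ v → Kind G v
kind {G = G} y v = kind-repoint {G = repoint G v} (pt G) (kind-pt (YBar-repoint y v))

deep-tree : {G : PortedGraph L D P} → YBar G → ∀ {v} → Deep G (suc k) v → IsTree G v
deep-tree {G = G} y {v} (d , z , e , _) = go (kind y v)
  where
  not-real : ∀ d → ¬ RealEdge G (inj₂ pm) z (inj₂ (dir d))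
  not-real false ()
  not-real true  ()
  go : Kind G v → IsTree G v
  go (inj₁ t) = t
  go (inj₂ r) = ⊥-elim (not-real d (IsReal.edges r e))

-- A child is one level deeper, the parent one level shallower. An edge from a root to a real vertex
-- would share the port `pm` with the edge to the first ancestor.
deep-neighbour : {G : PortedGraph L D P} → YBar G → ∀ {v a v' c} → Deep G (suc k) v → E G v a v' c → Deep G k v'
deep-neighbour {k = k} {G = G} y@(g , _) {v} h@(d , z , e , h') e' = go e' (IsTree.edges (deep-tree {k = k} y h) e')
  where
  go : ∀ {a v' c} → E G v a v' c → TreeEdge G a v' c → Deep G k v'
  go e' (child d' _)  = deep-mono {G = G} (≤-trans (n≤1+n k) (n≤1+n _)) (d' , v , IsGraph.E-sym g e' , h)
  go e' (parent _ _) with refl , _ ← IsGraph.E-fun g e e' = h'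
  go e' (root _)     with _ , q ← IsGraph.E-fun g e e' = ⊥-elim (pm≢dir d (sym q))

-- The ports come as equations because unification cannot invert `dir`. `parent` and `root` are
-- merged: both leave by `pm`, where uniqueness of the edge tells them apart.
tree-edge-split : {G : PortedGraph L D P} → ∀ {a v b} → TreeEdge G a v b →
                  (∃ λ d → a ≡ inj₂ (dir d) × b ≡ inj₂ pm × Tree G v) ⊎ a ≡ inj₂ pm
tree-edge-split (child d t)  = inj₁ (d , refl , refl , t)
tree-edge-split (parent _ _) = inj₂ refl
tree-edge-split (root _)     = inj₂ refl

dir-injective : ∀ {d d'} → inj₂ {A = P} (dir d) ≡ inj₂ (dir d') → d ≡ d'
dir-injective {d = false} {false} _ = refl
dir-injective {d = true}  {true}  _ = refl

-- Recovering the original graph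

module _ {G : PortedGraph L D P} where

  -- A Boolean, because `T` is proof irrelevant: a vertex of the original graph is then determined
  -- by the vertex of `G` underneath.
  real? : ∀ {v} → Kind G v → Bool
  real? (inj₁ _) = false
  real? (inj₂ _) = true

  real-sound : ∀ {v} (κ : Kind G v) → T (real? κ) → IsReal G v
  real-sound (inj₂ r) _ = r

  real-complete : ∀ {v} (κ : Kind G v) → ¬ Tree G v → T (real? κ)
  real-complete (inj₁ t) n = n (IsTree.label t)
  real-complete (inj₂ _) _ = tt

  tree-of-kind : ∀ {v} → Kind G v → Tree G v → IsTree G v
  tree-of-kind (inj₁ t) _ = t
  tree-of-kind (inj₂ r) t = ⊥-elim (IsReal.no-label r t)

module Originals {G : PortedGraph L D P} (g : IsGraph G) (κ : ∀ v → Kind G v)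
                 (real-pt : ¬ Tree G (pt G)) where
  open IsGraph g

  Orig : V G → Set
  Orig v = T (real? (κ v))

  is-real : ∀ {v} → Orig v → IsReal G v
  is-real {v} = real-sound (κ v)

  is-orig : ∀ {v} → ¬ Tree G v → Orig v
  is-orig {v} = real-complete (κ v)

  orig-≡ : ∀ {u v} {r : Orig u} {s : Orig v} → u ≡ v → _≡_ {A = Σ (V G) Orig} (u , r) (v , s)
  orig-≡ {r = r} {s} refl = cong (_ ,_) (T-irrelevant r s)

  X : Graph L D P
  X = record
    { V       = Σ (V G) Orig
    ; E       = λ (u , _) a (v , _) b → E G u (inj₁ a) v (inj₁ b)
    ; pt      = pt G , is-orig real-pt
    ; HasLab  = λ (v , _) l → HasLab G v (inj₁ l)
    ; HasELab = λ (v , _) a d → HasELab G v (inj₁ a) d }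

  -- Positions grow along edges from real vertices, so no depth is computed for a vertex of `G`. As
  -- the pointer is real and `G` connected, following a walk gives every vertex a position.
  data Pos : V G → AV X → Set where
    here   : ∀ {z r} → Pos z (inj₁ (z , r))
    root   : ∀ {z r v} → E G z (inj₂ pm) v (inj₂ pm) → Pos v (inj₂ ((z , r) , []))
    child  : ∀ {x p v v'} d → Pos v (inj₂ (x , p)) → E G v (inj₂ (dir d)) v' (inj₂ pm) →
             Pos v' (inj₂ (x , d ∷ p))

  pos-tree : ∀ {v x} → Pos v (inj₂ x) → IsTree G v
  pos-tree {v} (root {r = r} e) with up t ← IsReal.edges (is-real r) e = tree-of-kind (κ v) t
  pos-tree {v} (child d p e) with tree-edge-split (IsTree.edges (pos-tree p) e)
  ... | inj₁ (_ , _ , _ , t) = tree-of-kind (κ v) t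
  ... | inj₂ q = ⊥-elim (pm≢dir d (sym q))

  pos-edge : ∀ {v y v' a b} → Pos v y → E G v a v' b → ∃ λ y' → AE X y a y' b × Pos v' y'
  pos-edge (here {r = r}) e with IsReal.edges (is-real r) e
  ... | orig n = inj₁ (_ , is-orig n) , orig e , here
  ... | up _   = -, up , root e
  pos-edge p@(root _) e with tree-edge-split (IsTree.edges (pos-tree p) e)
  pos-edge p@(root _)  e | inj₁ (d , refl , refl , _) = -, toChild d , child d p e
  -- The edge at `pm` is unique, so it is the one by which the position was obtained.
  pos-edge (root e₀)   e | inj₂ refl with refl , refl ← E-fun (E-sym e₀) e = -, down , here
  pos-edge p@(child _ _ _) e with tree-edge-split (IsTree.edges (pos-tree p) e)
  pos-edge p@(child _ _ _) e | inj₁ (d , refl , refl , _) = -, toChild d , child d p e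
  pos-edge (child d p e₀)  e | inj₂ refl with refl , refl ← E-fun (E-sym e₀) e = -, toParent d , p

  pos-edge⁻ : ∀ {v y y' a b} → Pos v y → AE X y a y' b → ∃ λ v' → E G v a v' b × Pos v' y'
  pos-edge⁻ here            (orig e)     = -, e , here
  pos-edge⁻ (here {r = r})  up           = let _ , e = IsReal.root-of (is-real r) in -, e , root e
  pos-edge⁻ (root e)        down         = -, E-sym e , here
  pos-edge⁻ p               (toChild d)  = let _ , e = IsTree.children (pos-tree p) d in -, e , child d p e
  pos-edge⁻ (child d p e)   (toParent d) = -, E-sym e , p

  here≢tree : ∀ {v x} {A : Set} → Orig v → Pos v (inj₂ x) → A
  here≢tree r p = ⊥-elim (IsReal.no-label (is-real r) (IsTree.label (pos-tree p)))

  -- Induction along the unique edge at `pm`: its far port tells a root from a child, and a left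
  -- child from a right one.
  pos-func : ∀ {v y y'} → Pos v y → Pos v y' → y ≡ y'
  pos-func here            here        = cong inj₁ (orig-≡ refl)
  pos-func (here {r = r})  p@(root _)  = here≢tree r p
  pos-func (here {r = r})  p@(child _ _ _) = here≢tree r p
  pos-func p@(root _)      (here {r = r})  = here≢tree r p
  pos-func p@(child _ _ _) (here {r = r})  = here≢tree r p
  pos-func (root e)        (root e')   =
    cong (λ x → inj₂ (x , [])) (orig-≡ (proj₁ (E-fun (E-sym e) (E-sym e'))))
  pos-func (root e)        (child d _ e') = ⊥-elim (pm≢dir d (proj₂ (E-fun (E-sym e) (E-sym e'))))
  pos-func (child d _ e)   (root e')      = ⊥-elim (pm≢dir d (proj₂ (E-fun (E-sym e') (E-sym e))))
  pos-func (child d p e)   (child d' p' e') with E-fun (E-sym e) (E-sym e')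
  ... | refl , q with refl ← dir-injective q with refl ← pos-func p p' = refl

  pos-inj : ∀ {v v' y} → Pos v y → Pos v' y → v ≡ v'
  pos-inj here          here           = refl
  pos-inj (root e)      (root e')      = proj₁ (E-fun e e')
  pos-inj (child d p e) (child d p' e') with refl ← pos-inj p p' = proj₁ (E-fun e e')

  pos-lab : ∀ {v y l} → Pos v y → HasLab G v l → ALab X y l
  pos-lab {l = inj₁ _}  here           h = origL h
  pos-lab {l = inj₂ tt} (here {r = r}) h = ⊥-elim (IsReal.no-label (is-real r) h)
  pos-lab p@(root _)      h with refl ← lab-fun h (IsTree.label (pos-tree p)) = treeL
  pos-lab p@(child _ _ _) h with refl ← lab-fun h (IsTree.label (pos-tree p)) = treeL

  pos-lab⁻ : ∀ {v y l} → Pos v y → ALab X y l → HasLab G v l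
  pos-lab⁻ here (origL h) = h
  pos-lab⁻ p    treeL     = IsTree.label (pos-tree p)

  pos-elab : ∀ {v y a d} → Pos v y → HasELab G v a d → AELab X y a d
  pos-elab (here {r = r}) h with _ , _ , e ← elab-edge h with IsReal.edges (is-real r) e
  ... | orig _ = origE h
  -- By `elab-sym` the label would also sit at the root of a tree, which carries none.
  ... | up t   = ⊥-elim (IsTree.no-elab (tree-of-kind (κ _) t) (elab-sym e h))
  pos-elab p@(root _)      h = ⊥-elim (IsTree.no-elab (pos-tree p) h)
  pos-elab p@(child _ _ _) h = ⊥-elim (IsTree.no-elab (pos-tree p) h)

  pos-elab⁻ : ∀ {v y a d} → Pos v y → AELab X y a d → HasELab G v a d
  pos-elab⁻ here (origE h) = h

  pos-bisim : Bisim G (Attach X) Pos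
  pos-bisim =
    record { point = here ; edge = pos-edge ; func = pos-func ; lab = pos-lab ; elab = pos-elab } ,
    record { point = here ; edge = pos-edge⁻ ; func = pos-inj ; lab = pos-lab⁻ ; elab = pos-elab⁻ }

  base : AV X → V X
  base (inj₁ x)       = x
  base (inj₂ (x , _)) = x

  -- Collapsing each tree onto the vertex that carries it erases the tree steps. Walks of `G`, read
  -- in `Attach X`, thus become walks of `X` and show that it is connected.
  base-walk : ∀ {y y'} → Walk (Attach X) y w y' → ∃ λ w' → Walk X (base y) w' (base y')
  base-walk []                  = -, []
  base-walk (step (orig e) p)     = -, step e (proj₂ (base-walk p))
  base-walk (step up p)           = base-walk p
  base-walk (step down p)         = base-walk p
  base-walk (step (toChild _) p)  = base-walk p
  base-walk (step (toParent _) p) = base-walk p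

  X-graph : IsGraph X
  X-graph = record
    { E-sym     = E-sym
    ; E-fun     = λ e e' → let q , r = E-fun e e' in orig-≡ q , inj₁-injective r
    ; lab-fun   = λ h h' → inj₁-injective (lab-fun h h')
    ; elab-fun  = elab-fun
    ; elab-edge = λ {u} h → let _ , _ , e = elab-edge h in original-end u e (IsReal.edges (is-real (proj₂ u)) e)
    ; elab-sym  = elab-sym
    ; connected = conn }
    where
    original-end : ∀ (u : V X) {a v b} → E G (proj₁ u) (inj₁ a) v b → RealEdge G (inj₁ a) v b →
                   ∃₂ λ v b → E X u a v b
    original-end _ e (orig n) = (_ , is-orig n) , _ , e
    conn : ∀ v → ∃ λ w → Reach X w v
    conn (v , r) with _ , p ← connected v
                 with y , p' , c ← sim-walk (proj₁ pos-bisim) here p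
                 with refl ← pos-func c (here {r = r}) = base-walk p'

  originals-YSet : YSet G
  originals-YSet = g , X , X-graph , inj₁ (pt X) , bisim⇒≅ (graph-det (attach-graph X-graph)) pos-bisim

-- Dichotomy: membership in `YSet`, or depth

climb : {X : Graph L D P} (u : AV X) →
        ∃₂ λ w x → length w ≤ suc (depth {X = X} u) × Walk (Attach X) u w (inj₁ x)
climb (inj₁ x)           = [] , x , z≤n , []
climb (inj₂ (x , []))    = _ ∷ [] , x , s≤s z≤n , step down []
climb (inj₂ (x , d ∷ p)) with w , x' , l , q ← climb (inj₂ (x , p)) = _ ∷ w , x' , s≤s l , step (toParent d) q

deep-repoint : {G : PortedGraph L D P} → ∀ {u v} → Deep (repoint G u) k v → Deep G k v
deep-repoint {k = zero}  _               = tt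
deep-repoint {k = suc k} (d , z , e , h) = d , z , e , deep-repoint {k = k} h

-- In an approximation of radius `k`, a pointer of depth at least `k` shows `k` ancestors inside the
-- disk. Otherwise some real vertex lies within distance `k`, and re-pointing there puts the whole
-- graph in `YSet`.
YSet-or-deep-pt : {G : PortedGraph L D P} → YBar G → ∀ k → YSet G ⊎ Deep G k (pt G)
YSet-or-deep-pt {G = G} y@(g , _) k = go (approx y k)
  where
  go : (∃ λ X → IsGraph X × ∃ λ u → Bisim (disk (repoint (Attach X) u) k) (disk G k)
                                       (Corr (disk (repoint (Attach X) u) k) (disk G k))) →
       YSet G ⊎ Deep G k (pt G)
  go (X , gX , u , s , s') with k ≤? depth {X = X} u
  ... | yes l = inj₂ (deep-undisk {G = G} (sim-deep s (point s)
                  (deep-disk {G = repoint (Attach X) u} ([] , z≤n , []) (n≤1+n k) (deep-back (depth-deep u l)))))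
    where
    deep-back : ∀ {j y} → Deep (Attach X) j y → Deep (repoint (Attach X) u) j y
    deep-back {zero}  _               = tt
    deep-back {suc j} (d , z , e , h) = d , z , e , deep-back {j} h
  ... | no l with w , x , l' , p ← climb {X = X} u
             with v , q , c ← sim-walk s (point s)
                    (reach-disk (≤-trans l' (≤-trans (≰⇒> l) (n≤1+n k))) (walk-repoint p)) =
    inj₁ (YSet-repoint
      (Originals.originals-YSet (repoint-graph g v) (kind (YBar-repoint y v)) not-tree) (pt G))
    where
    not-tree : ¬ Tree G v
    -- Climbing takes at most one step more than the depth, hence at most `k`; at that distance the
    -- disk still shows labels.
    not-tree t with () ← proj₂ (lab s' c ((w , ≤-trans l' (≰⇒> l) , walk-undisk q) , t))

YSet-or-deep : {G : PortedGraph L D P} → YBar G → ∀ v k → YSet G ⊎ Deep G k v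
YSet-or-deep {G = G} y v k =
  Sum.map (λ s → YSet-repoint s (pt G)) (deep-repoint {G = G}) (YSet-or-deep-pt (YBar-repoint y v) k)

-- Agreement of two graphs around a pair of vertices

-- The comparison is made at a single vertex because the extension takes its edges from different
-- graphs at different vertices. The primed vertices are the candidate other ends of an edge.
record Agree (G H : Graph L D P) (x x' : V G) (y y' : V H) : Set where
  field
    edge⇔ : ∀ {a c} → E G x a x' c ⇔ E H y a y' c
    lab⇔  : ∀ {l} → HasLab G x l ⇔ HasLab H y l
    elab⇔ : ∀ {a d} → HasELab G x a d ⇔ HasELab H y a d
open Agree

agree-refl : ∀ {x x'} → Agree G G x x' x x'
agree-refl = record { edge⇔ = ⇔.refl ; lab⇔ = ⇔.refl ; elab⇔ = ⇔.refl }

agree-sym : ∀ {x x' y y'} → Agree G H x x' y y' → Agree H G y y' x x'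
agree-sym a = record { edge⇔ = ⇔.sym (edge⇔ a) ; lab⇔ = ⇔.sym (lab⇔ a) ; elab⇔ = ⇔.sym (elab⇔ a) }

agree-trans : ∀ {x x' y y' z z'} → Agree G H x x' y y' → Agree H K y y' z z' → Agree G K x x' z z'
agree-trans a b = record
  { edge⇔ = ⇔.trans (edge⇔ a) (edge⇔ b)
  ; lab⇔  = ⇔.trans (lab⇔ a) (lab⇔ b)
  ; elab⇔ = ⇔.trans (elab⇔ a) (elab⇔ b) }

agree-repoint : ∀ {u x x' y y'} → Agree (repoint G u) H x x' y y' → Agree G H x x' y y'
agree-repoint a = record { Agree a }

bisim-agree : ∀ {C x x' y y'} → Bisim G H C → C x y → C x' y' → Agree G H x x' y y'
bisim-agree {G = G} {H = H} {x = x} {y = y} (s , s') c c' = record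
  { edge⇔ = mk⇔ (λ e → let _ , e' , c″ = edge s c e in subst (λ z → E H y _ z _) (func s c″ c') e')
                (λ e → let _ , e' , c″ = edge s' c e in subst (λ z → E G x _ z _) (func s' c″ c') e')
  ; lab⇔  = mk⇔ (lab s c) (lab s' c)
  ; elab⇔ = mk⇔ (elab s c) (elab s' c) }

corr-agree : ∀ {x x' y y'} → IsGraph G → IsGraph H → G ≅ H → Corr G H x y → Corr G H x' y' →
             Agree G H x x' y y'
corr-agree g h i = bisim-agree (≅⇒bisim (graph-det g) (graph-det h) i)

total-bisim : ∀ {C} → C (pt G) (pt H) → (∀ x → ∃ (C x)) → (∀ y → ∃ λ x → C x y) →
              (∀ {x y y'} → C x y → C x y' → y ≡ y') → (∀ {x x' y} → C x y → C x' y → x ≡ x') →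
              (∀ {x x' y y'} → C x y → C x' y' → Agree G H x x' y y') → Bisim G H C
total-bisim p total onto fun inj agree =
  record { point = p
         ; edge = λ c e → let _ , c' = total _ in -, to (edge⇔ (agree c c')) e , c'
         ; func = fun
         ; lab  = λ c → to (lab⇔ (agree c c))
         ; elab = λ c → to (elab⇔ (agree c c)) } ,
  record { point = p
         ; edge = λ c e → let _ , c' = onto _ in -, from (edge⇔ (agree c c')) e , c'
         ; func = inj
         ; lab  = λ c → from (lab⇔ (agree c c))
         ; elab = λ c → from (elab⇔ (agree c c)) }

bisim-corr : ∀ {C x y} → IsGraph G → Bisim G H C → C x y → Corr G H x y
bisim-corr {x = x} g (s , _) c with w , p ← IsGraph.connected g x
                       with _ , q , c' ← sim-walk s (point s) p with refl ← func s c c' = w , p , q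

-- The path behind `Corr` may be too long for a smaller disk. The distance bound on one side
-- supplies a short one, and the simulation carries it to the other side.
short-corr : ∀ {x y} → IsGraph G → IsGraph H → disk G n ≅ disk H n → m ≤ n → Corr (disk G n) (disk H n) x y →
             InDisk G m x ⊎ InDisk H m y → ∃ λ q → length q ≤ suc m × Reach G q x × Reach H q y
short-corr {G = G} {H = H} g h i m≤n c (inj₁ (q , l , p))
  with s , _ ← ≅⇒bisim (disk-det _ (graph-det g)) (disk-det _ (graph-det h)) i
  with _ , p' , c' ← sim-walk s (point s) (reach-disk (≤-trans l (s≤s m≤n)) p)
  with refl ← func s c c' = q , l , p , walk-undisk p'
short-corr {G = G} {H = H} g h i m≤n c (inj₂ (q , l , p))
  with _ , s ← ≅⇒bisim (disk-det _ (graph-det g)) (disk-det _ (graph-det h)) i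
  with _ , p' , c' ← sim-walk s (point s) (reach-disk (≤-trans l (s≤s m≤n)) p)
  with refl ← func s c c' = q , l , walk-undisk p' , p

no-child-edge : {G : PortedGraph L D P} → ∀ d {v b} → ¬ RealEdge G (inj₂ (dir d)) v b
no-child-edge false ()
no-child-edge true  ()

-- Addresses of nodes list the last direction first, hence the reversal.
attach-treeWord : {X : Graph L D P} → ∀ x s p → Walk (Attach X) (inj₂ (x , p)) (treeWord s) (inj₂ (x , s ʳ++ p))
attach-treeWord x []      p = []
attach-treeWord x (d ∷ s) p = step (toChild d) (attach-treeWord x s (d ∷ p))

-- The extension to the closure

module Extension (Dy : Dynamics (YSet {L} {D} {P})) (continuous : Continuous Dy)
                 (shift : ShiftInvariant Dy) (bijective : VertexPreserving Dy)
                 (b : ℕ)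
                 (quiet : ∀ (X : Graph L D P) → IsGraph X → ∀ (s t : List Bool) → b ≤ length s →
                    ∀ y → Reach (Attach X) (mmStep ∷ treeWord s) y →
                    ∀ (sy : YSet (repoint (Attach X) y)) →
                    ∀ x → Walk (Attach X) y (treeWord t) x →
                    Reach (Dynamics.F Dy (repoint (Attach X) y) sy) (treeWord t)
                          (Dynamics.R Dy (repoint (Attach X) y) sy x)) where
  open Dynamics Dy

  private variable
    A B : PortedGraph L D P

  F-graph : (y : YSet A) → IsGraph (F A y)
  F-graph y = proj₁ (F-in _ y)

  R-injective : (y : YSet A) → ∀ {u v} → R A y u ≡ R A y v → u ≡ v
  R-injective y = proj₁ (bijective _ y)

  R-surjective : (y : YSet A) → ∀ z → ∃ λ x → R A y x ≡ z
  R-surjective y z = let x , q = proj₂ (bijective _ y) z in x , q refl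

  -- Shift-invariance at the pointer itself forces R to fix the pointer: a word from the
  -- pointer of F A to R (pt A) also leads from R (pt A) to itself.
  R-pt : (y : YSet A) → R A y (pt A) ≡ pt (F A y)
  R-pt {A} y = let q , p = IsGraph.connected (F-graph y) (R A y (pt A))
               in walk-codet (graph-det (F-graph y)) (proj₂ (shift A y (pt A) y) (pt A) q p) p

  R-agree : (y : YSet A) (z : YSet B) → A ≅ B → ∀ {u u' v v'} → Corr A B u v → Corr A B u' v' →
            Agree (F A y) (F B z) (R A y u) (R A y u') (R B z v) (R B z v')
  R-agree y z i (_ , p , q) (_ , p' , q') =
    corr-agree (F-graph y) (F-graph z) (F-cong y z i) (R-cong y z i p q) (R-cong y z i p' q')

  -- The second clause of shift-invariance lets one path lead to the image of `x` in both graphs,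
  -- which makes the images correspond.
  R-agree-repoint : (y : YSet A) → ∀ u (t : YSet (repoint A u)) x x' →
                    Agree (F A y) (F (repoint A u) t) (R A y x) (R A y x') (R (repoint A u) t x) (R (repoint A u) t x')
  R-agree-repoint {A} y u t x x' = agree-repoint
    (corr-agree (repoint-graph (F-graph y) _) (F-graph t) (≅-sym (proj₁ (shift A y u t))) (corr x) (corr x'))
    where
    corr : ∀ x → Corr (repoint (F A y) (R A y u)) (F (repoint A u) t) (R A y x) (R (repoint A u) t x)
    corr x = let q , p = IsGraph.connected (F-graph t) (R (repoint A u) t x)
             in q , walk-repoint (proj₂ (shift A y u t) x q p) , p

  -- Quiescence concerns paths from the pointer, so `v` is made the pointer: there the one-letter
  -- word `d` leads to the image of the child. Shift-invariance turns this path into an edge leaving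
  -- `R A y v`.
  R-child : (y : YSet A) → ∀ {v v' d} → Deep A b v → IsTree A v →
            E A v (inj₂ (dir d)) v' (inj₂ pm) → E (F A y) (R A y v) (inj₂ (dir d)) (R A y v') (inj₂ pm)
  R-child {A} y@(g , X , gX , u , i) {v} {v'} {d} h t e = go (corr-total g i v)
    where
    gA = repoint-graph (attach-graph gX) u
    bs = ≅⇒bisim (graph-det g) (graph-det gA) i
    go : (∃ λ v₀ → Corr A (repoint (Attach X) u) v v₀) → E (F A y) (R A y v) (inj₂ (dir d)) (R A y v') (inj₂ pm)
    go (v₀ , c) with lab (proj₁ bs) c (IsTree.label t)
    ... | treeL {x = x , p} = result (proj₂ (shift A y v sv) v' _ walk)
      where
      -- With the pointer at the vertex that carries the tree of `v`, the path to `v` is `mmStep`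
      -- followed by a tree word as long as the depth of `v`.
      X' = repoint X x
      gX' = repoint-graph gX x
      Z = repoint (Attach X') (inj₂ (x , p))
      sZ : YSet Z
      sZ = attach-YSet gX' (inj₂ (x , p))
      sv : YSet (repoint A v)
      sv = YSet-repoint y v
      Z≅ : Z ≅ repoint A v
      Z≅ = ≅-trans (attach-repoint gX x (inj₂ (x , p)))
             (≅-sym (bisim⇒≅ (graph-det (repoint-graph (attach-graph gX) (inj₂ (x , p)))) (bisim-repoint bs c)))
      reach : Reach (Attach X') (mmStep ∷ treeWord (reverse p)) (inj₂ (x , p))
      reach = step up (subst (λ q → Walk (Attach X') (inj₂ (x , [])) (treeWord (reverse p)) (inj₂ (x , q)))
                             (reverse-involutive p) (attach-treeWord x (reverse p) []))
      deep : b ≤ length (reverse p)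
      deep = subst (b ≤_) (sym (length-reverse p))
               (attach-deep {X = X} {y = inj₂ (x , p)} (deep-repoint {G = Attach X} {u = u} (sim-deep (proj₁ bs) c h)))
      walkZ : Reach (F Z sZ) (treeWord (d ∷ [])) (R Z sZ (inj₂ (x , d ∷ p)))
      walkZ = quiet X' gX' (reverse p) (d ∷ []) deep _ reach sZ _ (step (toChild d) [])
      corr : Corr (F Z sZ) (F (repoint A v) sv) (R Z sZ (inj₂ (x , d ∷ p))) (R (repoint A v) sv v')
      corr = R-cong sZ sv Z≅ {w = treeWord (d ∷ [])} (step (toChild d) []) (step e [])
      walk : Reach (F (repoint A v) sv) (treeWord (d ∷ [])) (R (repoint A v) sv v')
      walk = let s = proj₁ (≅⇒bisim (graph-det (F-graph sZ)) (graph-det (F-graph sv)) (F-cong sZ sv Z≅))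
                 _ , q , c' = sim-walk s (point s) walkZ
             in subst (Reach (F (repoint A v) sv) _) (func s c' corr) q
      result : ∀ {a c x z} → Walk (F A y) x ((a , c) ∷ []) z → E (F A y) x a z c
      result (step e []) = e

  -- Depth `suc b` leaves depth `b` at the parent, where `R-child` gives the edge between the two.
  -- The image has a child edge and is therefore a tree vertex; its three usable ports are already
  -- occupied by images of edges of `v`.
  R-deep-agree : (y : YSet A) → ∀ {v} → Deep A (suc b) v → ∀ v' → Agree A (F A y) v v' (R A y v) (R A y v')
  R-deep-agree {A} y@(g , _) {v} h@(d₀ , z₀ , e₀ , _) v' = record
    { edge⇔ = mk⇔ fwd (λ e → let _ , e' , q = bwd e in subst (λ z → E A v _ z _) (R-injective y q) e')
    ; lab⇔  = mk⇔ (λ l → subst (HasLab (F A y) _) (IsGraph.lab-fun g (IsTree.label tree) l) (IsTree.label treeF))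
                  (λ l → subst (HasLab A _) (IsGraph.lab-fun gF (IsTree.label treeF) l) (IsTree.label tree))
    ; elab⇔ = mk⇔ (⊥-elim ∘ IsTree.no-elab tree) (⊥-elim ∘ IsTree.no-elab treeF) }
    where
    gF = F-graph y
    yb = YSet⇒YBar y
    tree : IsTree A v
    tree = deep-tree {k = b} yb h
    fwd : ∀ {a w c} → E A v a w c → E (F A y) (R A y v) a (R A y w) c
    fwd {a} {w} {c} e = go e (IsTree.edges tree e)
      where
      go : ∀ {a w c} → E A v a w c → TreeEdge A a w c → E (F A y) (R A y v) a (R A y w) c
      go e (child d _)  = R-child y (deep-mono {G = A} (n≤1+n b) h) tree e
      go {w = w} e (parent d t) =
        IsGraph.E-sym gF (R-child y (deep-neighbour {k = b} yb h e) (tree-of-kind (kind yb w) t) (IsGraph.E-sym g e))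
      go e (root _) = ⊥-elim (pm≢dir d₀ (proj₂ (IsGraph.E-fun g e e₀)))
    treeF : IsTree (F A y) (R A y v)
    treeF = go (kind (YSet⇒YBar (F-in A y)) (R A y v))
      where
      go : Kind (F A y) (R A y v) → IsTree (F A y) (R A y v)
      go (inj₁ t) = t
      go (inj₂ r) = ⊥-elim (no-child-edge {G = F A y} false (IsReal.edges r (fwd (proj₂ (IsTree.children tree false)))))
    bwd : ∀ {a z c} → E (F A y) (R A y v) a z c → ∃ λ w → E A v a w c × R A y w ≡ z
    bwd {a} {z} {c} e = go e (tree-edge-split (IsTree.edges treeF e))
      where
      go : ∀ {a z c} → E (F A y) (R A y v) a z c →
           (∃ λ d → a ≡ inj₂ (dir d) × c ≡ inj₂ pm × Tree (F A y) z) ⊎ a ≡ inj₂ pm → ∃ λ w → E A v a w c × R A y w ≡ z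
      go e (inj₁ (d , refl , refl , _)) =
        let w , e' = IsTree.children tree d in w , e' , proj₁ (IsGraph.E-fun gF (fwd e') e)
      go e (inj₂ refl) = let q , r = IsGraph.E-fun gF (fwd e₀) e in z₀ , subst (E A v (inj₂ pm) z₀) r e₀ , q

  -- Assembling the image

  Local : (A : PortedGraph L D P) → V A → Set₁
  Local A v = YSet A ⊎ Deep A (suc b) v

  at : ∀ {v} → Local A v → PortedGraph L D P
  at {A} (inj₁ y) = F A y
  at {A} (inj₂ _) = A

  emb : ∀ {v} (ι : Local A v) → V A → V (at ι)
  emb {A} (inj₁ y) = R A y
  emb     (inj₂ _) = id

  -- Membership in YSet is undecidable, so the image is assembled vertex by vertex, each vertex
  -- being either in a graph known to be in YSet or known to be deep in the invisible matter.
  extend : (A : PortedGraph L D P) → (∀ v → Local A v) → PortedGraph L D P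
  extend A ℓ = record
    { V       = V A
    ; E       = λ u a v c → E (at (ℓ u)) (emb (ℓ u) u) a (emb (ℓ u) v) c
    ; pt      = pt A
    ; HasLab  = λ v l → HasLab (at (ℓ v)) (emb (ℓ v) v) l
    ; HasELab = λ v a d → HasELab (at (ℓ v)) (emb (ℓ v) v) a d }

  module _ {A : PortedGraph L D P} (ℓ : ∀ v → Local A v) where

    extend-at : ∀ x x' → Agree (extend A ℓ) (at (ℓ x)) x x' (emb (ℓ x) x) (emb (ℓ x) x')
    extend-at x x' = record { edge⇔ = ⇔.refl ; lab⇔ = ⇔.refl ; elab⇔ = ⇔.refl }

    -- The choice made by `ℓ` is immaterial: two proofs of membership give corresponding images by
    -- congruence, and at a deep vertex `F` acts as the identity.
    extend-agree : (y : YSet A) → ∀ x x' → Agree (extend A ℓ) (F A y) x x' (R A y x) (R A y x')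
    extend-agree y x x' = agree-trans (extend-at x x') (go (ℓ x))
      where
      corr : ∀ x → Corr A A x x
      corr x = let w , p = IsGraph.connected (proj₁ y) x in w , p , p
      go : (ι : Local A x) → Agree (at ι) (F A y) (emb ι x) (emb ι x') (R A y x) (R A y x')
      go (inj₁ y') = R-agree y' y (≅-refl (graph-det (proj₁ y))) (corr x) (corr x')
      go (inj₂ h)  = R-deep-agree y h x'

    extend-deep-agree : ∀ {x} → Deep A (suc b) x → ∀ x' → Agree (extend A ℓ) A x x' x x'
    extend-deep-agree {x} h x' = agree-trans (extend-at x x') (go (ℓ x))
      where
      go : (ι : Local A x) → Agree (at ι) A (emb ι x) (emb ι x') x x'
      go (inj₁ y) = agree-sym (R-deep-agree y h x')
      go (inj₂ _) = agree-refl

    extend-bisim : (y : YSet A) → Bisim (extend A ℓ) (F A y) (λ x z → R A y x ≡ z)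
    extend-bisim y = total-bisim (R-pt y) (λ x → -, refl) (R-surjective y)
      (λ { refl refl → refl }) (λ { q refl → R-injective y q })
      (λ { {x} {x'} refl refl → extend-agree y x x' })

    -- The choices met along a finite walk either yield a proof of membership in `YSet` or certify
    -- every vertex it leaves as deep, and then the walk survives unchanged.
    walk-extend : ∀ {u w v} → Walk A u w v → YSet A ⊎ Walk (extend A ℓ) u w v
    walk-extend [] = inj₂ []
    walk-extend (step {u = u} {v = v} e p) = go (ℓ u) (walk-extend p)
      where
      go : Local A u → YSet A ⊎ Walk (extend A ℓ) v _ _ → YSet A ⊎ Walk (extend A ℓ) u _ _
      go (inj₁ y) _        = inj₁ y
      go (inj₂ h) (inj₁ y) = inj₁ y
      go (inj₂ h) (inj₂ q) = inj₂ (step (from (edge⇔ (extend-deep-agree h v)) e) q)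

    both : ∀ {u v} → Local A u → Local A v → YSet A ⊎ (Deep A (suc b) u × Deep A (suc b) v)
    both (inj₁ y) _        = inj₁ y
    both (inj₂ _) (inj₁ y) = inj₁ y
    both (inj₂ h) (inj₂ k) = inj₂ (h , k)

    extend-graph : IsGraph A → IsGraph (extend A ℓ)
    extend-graph g = record
      { E-sym     = λ {u} {_} {v} e → esym e (both (ℓ u) (ℓ v))
      ; E-fun     = λ {u} e e' → efun e e' (ℓ u)
      ; lab-fun   = λ {v} h h' → lfun h h' (ℓ v)
      ; elab-fun  = λ {v} h h' → elfun h h' (ℓ v)
      ; elab-edge = λ {u} h → eledge h (ℓ u)
      ; elab-sym  = λ {u} {_} {v} e h → elsym e h (both (ℓ u) (ℓ v))
      ; connected = λ v → let _ , p = IsGraph.connected g v in conn v p (walk-extend p) }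
      where
      open IsGraph g
      A' = extend A ℓ
      module F (y : YSet A) = IsGraph (F-graph y)
      esym : ∀ {u a v c} → E A' u a v c → YSet A ⊎ (Deep A (suc b) u × Deep A (suc b) v) → E A' v c u a
      esym e (inj₁ y)       = from (edge⇔ (extend-agree y _ _)) (F.E-sym y (to (edge⇔ (extend-agree y _ _)) e))
      esym e (inj₂ (h , k)) = from (edge⇔ (extend-deep-agree k _)) (E-sym (to (edge⇔ (extend-deep-agree h _)) e))
      efun : ∀ {u a v c v' c'} → E A' u a v c → E A' u a v' c' → Local A u → v ≡ v' × c ≡ c'
      efun e e' (inj₁ y) =
        let q , r = F.E-fun y (to (edge⇔ (extend-agree y _ _)) e) (to (edge⇔ (extend-agree y _ _)) e')
        in R-injective y q , r
      efun e e' (inj₂ h) = E-fun (to (edge⇔ (extend-deep-agree h _)) e) (to (edge⇔ (extend-deep-agree h _)) e')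
      lfun : ∀ {v l l'} → HasLab A' v l → HasLab A' v l' → Local A v → l ≡ l'
      lfun {v} h h' (inj₁ y) = F.lab-fun y (to (lab⇔ (extend-agree y v v)) h) (to (lab⇔ (extend-agree y v v)) h')
      lfun {v} h h' (inj₂ k) = lab-fun (to (lab⇔ (extend-deep-agree k v)) h) (to (lab⇔ (extend-deep-agree k v)) h')
      elfun : ∀ {v a d d'} → HasELab A' v a d → HasELab A' v a d' → Local A v → d ≡ d'
      elfun {v} h h' (inj₁ y) = F.elab-fun y (to (elab⇔ (extend-agree y v v)) h) (to (elab⇔ (extend-agree y v v)) h')
      elfun {v} h h' (inj₂ k) = elab-fun (to (elab⇔ (extend-deep-agree k v)) h) (to (elab⇔ (extend-deep-agree k v)) h')
      eledge : ∀ {u a d} → HasELab A' u a d → Local A u → ∃₂ λ v c → E A' u a v c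
      eledge {u} {a} h (inj₁ y) =
        let z , c , e = F.elab-edge y (to (elab⇔ (extend-agree y u u)) h)
            -- The image keeps the vertices of `A`, so the end found in `F A y` is pulled back along
            -- `R`.
            x , q     = R-surjective y z
        in x , c , from (edge⇔ (extend-agree y u x)) (subst (λ z → E (F A y) (R A y u) a z c) (sym q) e)
      eledge {u} h (inj₂ k) =
        let z , c , e = elab-edge (to (elab⇔ (extend-deep-agree k u)) h)
        in z , c , from (edge⇔ (extend-deep-agree k z)) e
      elsym : ∀ {u a v c d} → E A' u a v c → HasELab A' u a d →
              YSet A ⊎ (Deep A (suc b) u × Deep A (suc b) v) → HasELab A' v c d
      elsym {u} {_} {v} e h (inj₁ y) = from (elab⇔ (extend-agree y v v))
        (F.elab-sym y (to (edge⇔ (extend-agree y u v)) e) (to (elab⇔ (extend-agree y u u)) h))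
      elsym {u} {_} {v} e h (inj₂ (k , k')) = from (elab⇔ (extend-deep-agree k' v))
        (elab-sym (to (edge⇔ (extend-deep-agree k v)) e) (to (elab⇔ (extend-deep-agree k u)) h))
      conn : ∀ v {w} → Reach A w v → YSet A ⊎ Reach A' w v → ∃ λ w → Reach A' w v
      conn v _ (inj₂ p) = -, p
      conn v _ (inj₁ y) =
        let s , s'     = extend-bisim y
            q , p      = F.connected y (R A y v)
            v' , p' , c = sim-walk s' (point s') p
        in q , subst (Reach A' q) (R-injective y c) p'

    extend-≅ : (y : YSet A) → extend A ℓ ≅ F A y
    extend-≅ y = bisim⇒≅ (graph-det (F-graph y)) (extend-bisim y)

    module _ (yb : YBar A) where

      -- Each step costs at most one level, so depth `j + suc b` keeps all vertices on a walk of at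
      -- most `j` steps deep enough for `extend-deep-agree`.
      deep-walk-extend : ∀ j {v w x} → Deep A (j + suc b) v → length w ≤ j → Walk A v w x →
                         Walk (extend A ℓ) v w x × Deep A (suc b) x
      deep-walk-extend j       h l       []         = [] , deep-mono {G = A} (m≤n+m _ j) h
      deep-walk-extend (suc j) h (s≤s l) (step e p) =
        let q , h' = deep-walk-extend j (deep-neighbour yb h e) l p
        in step (from (edge⇔ (extend-deep-agree (deep-mono {G = A} (m≤n+m _ (suc j)) h) _)) e) q , h'

      deep-walk-restrict : ∀ j {v w x} → Deep A (j + suc b) v → length w ≤ j → Walk (extend A ℓ) v w x → Walk A v w x
      deep-walk-restrict j       h l       []         = []
      deep-walk-restrict (suc j) h (s≤s l) (step e p) =
        let e' = to (edge⇔ (extend-deep-agree (deep-mono {G = A} (m≤n+m _ (suc j)) h) _)) e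
        in step e' (deep-walk-restrict j (deep-neighbour yb h e') l p)

      -- A disk of radius `m` extends to distance `suc m`, hence the depth `suc m + suc b`.
      module _ (m : ℕ) (h : Deep A (suc m + suc b) (pt A)) where

        dist-extend : ∀ {k x} → k ≤ suc m → DistLe A k x → DistLe (extend A ℓ) k x
        dist-extend k≤ (w , l , p) = w , l , proj₁ (deep-walk-extend (suc m) h (≤-trans l k≤) p)

        dist-restrict : ∀ {k x} → k ≤ suc m → DistLe (extend A ℓ) k x → DistLe A k x
        dist-restrict k≤ (w , l , p) = w , l , deep-walk-restrict (suc m) h (≤-trans l k≤) p

        near-agree : ∀ {k x} → k ≤ suc m → DistLe A k x → ∀ x' → Agree (extend A ℓ) A x x' x x'
        near-agree k≤ (w , l , p) = extend-deep-agree (proj₂ (deep-walk-extend (suc m) h (≤-trans l k≤) p))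

        deep-disk-bisim : Bisim (disk (extend A ℓ) m) (disk A m) _≡_
        deep-disk-bisim =
          record { point = refl
                 ; edge  = λ { refl (e , i , i') →
                     let j = dist-restrict ≤-refl i
                     in -, (to (edge⇔ (near-agree ≤-refl j _)) e , j , dist-restrict ≤-refl i') , refl }
                 ; func  = λ { refl refl → refl }
                 ; lab   = λ { {x} refl (i , l) →
                     let j = dist-restrict m≤ i in j , to (lab⇔ (near-agree m≤ j x)) l }
                 ; elab  = λ { {x} refl (l , i , _ , _ , e , i') →
                     let j = dist-restrict m≤ i
                     in to (elab⇔ (near-agree m≤ j x)) l , j , -, -, to (edge⇔ (near-agree m≤ j _)) e , dist-restrict m≤ i' } } ,
          record { point = refl
                 ; edge  = λ { refl (e , i , i') →
                     -, (from (edge⇔ (near-agree ≤-refl i _)) e , dist-extend ≤-refl i , dist-extend ≤-refl i') , refl }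
                 ; func  = λ { refl refl → refl }
                 ; lab   = λ { {x} refl (i , l) → dist-extend m≤ i , from (lab⇔ (near-agree m≤ i x)) l }
                 ; elab  = λ { {x} refl (l , i , _ , _ , e , i') →
                     from (elab⇔ (near-agree m≤ i x)) l , dist-extend m≤ i ,
                     -, -, from (edge⇔ (near-agree m≤ i _)) e , dist-extend m≤ i' } }
          where m≤ = n≤1+n m

        deep-disk-≅ : disk (extend A ℓ) m ≅ disk A m
        deep-disk-≅ = bisim⇒≅ (disk-det m (graph-det (proj₁ yb))) deep-disk-bisim

      -- At each radius the approximation is `F A y`, or, below a deep pointer, the one that `A`
      -- already has, since the disk is unchanged.
      extend-YBar : YBar (extend A ℓ)
      extend-YBar = extend-graph (proj₁ yb) , λ r → go r (YSet-or-deep-pt yb (suc r + suc b))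
        where
        go : ∀ r → YSet A ⊎ Deep A (suc r + suc b) (pt A) → ∃ λ Y → YSet Y × disk Y r ≅ disk (extend A ℓ) r
        go r (inj₁ y) = F A y , F-in A y ,
          ≅-disk (F-graph y) (extend-graph (proj₁ yb)) r (≅-sym (extend-≅ y))
        go r (inj₂ h) = let Y , y , i = proj₂ yb r in Y , y , ≅-trans i (≅-sym (deep-disk-≅ r h))

  -- Compatibility with isomorphism and re-pointing

  module _ {A B : PortedGraph L D P} (ℓ : ∀ v → Local A v) (ℓ' : ∀ v → Local B v)
           (gA : IsGraph A) (gB : IsGraph B) where

    -- A proof of membership in `YSet` met on one side passes to the other along `A ≅ B`, so mixed
    -- choices reduce to the case of two members.
    extend-cong-bisim : A ≅ B → Bisim (extend A ℓ) (extend B ℓ') (Corr A B)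
    extend-cong-bisim i = total-bisim ([] , [] , []) (corr-total gA i)
      (λ y → let x , c = corr-total gB (≅-sym i) y in x , corr-sym {G = B} {H = A} c)
      (func (proj₁ bs)) (func (proj₂ bs)) (λ {u} {_} {v} → agree (ℓ u) (ℓ' v))
      where
      bs = ≅⇒bisim (graph-det gA) (graph-det gB) i
      agree-YSet : YSet A → YSet B → ∀ {u u' v v'} → Corr A B u v → Corr A B u' v' →
                   Agree (extend A ℓ) (extend B ℓ') u u' v v'
      agree-YSet y z c c' = agree-trans (extend-agree ℓ y _ _)
        (agree-trans (R-agree y z i c c') (agree-sym (extend-agree ℓ' z _ _)))
      agree : ∀ {u u' v v'} → Local A u → Local B v → Corr A B u v → Corr A B u' v' →
              Agree (extend A ℓ) (extend B ℓ') u u' v v'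
      agree (inj₁ y) _        c c' = agree-YSet y (YSet-≅ gB i y) c c'
      agree (inj₂ _) (inj₁ z) c c' = agree-YSet (YSet-≅ gA (≅-sym i) z) z c c'
      agree (inj₂ h) (inj₂ k) c c' = agree-trans (extend-deep-agree ℓ h _)
        (agree-trans (corr-agree gA gB i c c') (agree-sym (extend-deep-agree ℓ' k _)))

    extend-cong : A ≅ B → extend A ℓ ≅ extend B ℓ'
    extend-cong i = bisim⇒≅ (graph-det (extend-graph ℓ' gB)) (extend-cong-bisim i)

    extend-corr : A ≅ B → ∀ {x y} → Corr A B x y → Corr (extend A ℓ) (extend B ℓ') x y
    extend-corr i = bisim-corr (extend-graph ℓ gA) (extend-cong-bisim i)

  extend-repoint-bisim : (u : V A) (ℓ : ∀ v → Local A v) (ℓ' : ∀ v → Local (repoint A u) v) →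
                         Bisim (extend (repoint A u) ℓ') (repoint (extend A ℓ) u) _≡_
  extend-repoint-bisim {A} u ℓ ℓ' = total-bisim refl (λ x → x , refl) (λ x → x , refl)
    (λ { refl refl → refl }) (λ { refl refl → refl })
    (λ { {x} {x'} refl refl → record { Agree (agree-sym (agree (ℓ x) (ℓ' x) x')) } })
    where
    agree-YSet : YSet A → YSet (repoint A u) → ∀ x x' → Agree (extend A ℓ) (extend (repoint A u) ℓ') x x' x x'
    agree-YSet y t x x' = agree-trans (extend-agree ℓ y x x')
      (agree-trans (R-agree-repoint y u t x x') (agree-sym (extend-agree ℓ' t x x')))
    agree : ∀ {x} → Local A x → Local (repoint A u) x → ∀ x' → Agree (extend A ℓ) (extend (repoint A u) ℓ') x x' x x'
    agree {x} (inj₁ y) _        x' = agree-YSet y (YSet-repoint y u) x x'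
    agree {x} (inj₂ _) (inj₁ t) x' = agree-YSet (YSet-repoint t (pt A)) t x x'
    agree {x} (inj₂ h) (inj₂ k) x' = agree-trans (extend-deep-agree ℓ h x')
      (agree-repoint {u = u} (agree-sym (extend-deep-agree ℓ' k x')))

  -- Continuity of the extension

  ContinuousAt : ∀ {A B} → (∀ v → Local A v) → (∀ v → Local B v) → ℕ → ℕ → Set
  ContinuousAt {A} {B} ℓ ℓ' m n =
      (disk (extend A ℓ) m ≅ disk (extend B ℓ') m)
    × (∀ x → InDisk (extend A ℓ) m x → InDisk A n x)
    × (∀ y → InDisk (extend B ℓ') m y → InDisk B n y)
    × (∀ {w x y} → Reach (disk A n) w x → Reach (disk B n) w y →
         InDisk (extend A ℓ) m x ⊎ InDisk (extend B ℓ') m y →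
         Corr (disk (extend A ℓ) m) (disk (extend B ℓ') m) x y)

  module _ {A B : PortedGraph L D P} (ℓ : ∀ v → Local A v) (ℓ' : ∀ v → Local B v) (m : ℕ) where

    -- The common disk shows the pointer of `B` to be equally deep, so both images coincide with
    -- their arguments on the disk of radius `m`.
    continuous-deep : YBar A → YBar B → Deep A (suc m + suc b) (pt A) →
                      ∀ {n} → suc m + suc b ≤ n → disk A n ≅ disk B n → ContinuousAt ℓ ℓ' m n
    continuous-deep ya@(gA , _) yb@(gB , _) h {n} l i =
      ≅-trans (deep-disk-≅ ℓ ya m h)
        (≅-trans (≅-disk-shrink gA gB m≤n i) (≅-sym (deep-disk-≅ ℓ' yb m h'))) ,
      (λ x → DistLe-mono (s≤s m≤n) ∘ dist-restrict ℓ ya m h ≤-refl) ,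
      (λ y → DistLe-mono (s≤s m≤n) ∘ dist-restrict ℓ' yb m h' ≤-refl) ,
      (λ {w} p q d →
        let r , l' , p' , q' = short-corr gA gB i m≤n (w , p , q)
              (Sum.map (dist-restrict ℓ ya m h ≤-refl) (dist-restrict ℓ' yb m h' ≤-refl) d)
        in r , reach-disk l' (proj₁ (deep-walk-extend ℓ ya (suc m) h l' p'))
             , reach-disk l' (proj₁ (deep-walk-extend ℓ' yb (suc m) h' l' q')))
      where
      h' : Deep B (suc m + suc b) (pt B)
      h' = ≅-disk-deep gA gB i (≤-trans l (n≤1+n n)) h
      m≤n : m ≤ n
      m≤n = ≤-trans (≤-trans (n≤1+n m) (m≤m+n (suc m) (suc b))) l

    continuous-YSet : (y : YSet A) (z : YSet B) → ∀ {n} → proj₁ (continuous A y m) ≤ n → disk A n ≅ disk B n →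
                      ContinuousAt ℓ ℓ' m n
    continuous-YSet y@(gA , _) z@(gB , _) {n} l i =
      transport (proj₁ (continuous A y m)) l (proj₂ (continuous A y m) B z (≅-disk-shrink gA gB l i))
      where
      distA : ∀ {k x} → DistLe (extend A ℓ) k x → DistLe (F A y) k (R A y x)
      distA = sim-dist (proj₁ (extend-bisim ℓ y)) refl
      distB : ∀ {k x} → DistLe (extend B ℓ') k x → DistLe (F B z) k (R B z x)
      distB = sim-dist (proj₁ (extend-bisim ℓ' z)) refl
      backA : ∀ {w x} → Reach (disk (F A y) m) w (R A y x) → Reach (disk (extend A ℓ) m) w x
      backA p = let s      = proj₂ (bisim-disk m (extend-bisim ℓ y))
                    _ , q , c = sim-walk s (point s) p
                in subst (Reach (disk (extend A ℓ) m) _) (R-injective y c) q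
      backB : ∀ {w x} → Reach (disk (F B z) m) w (R B z x) → Reach (disk (extend B ℓ') m) w x
      backB p = let s      = proj₂ (bisim-disk m (extend-bisim ℓ' z))
                    _ , q , c = sim-walk s (point s) p
                in subst (Reach (disk (extend B ℓ') m) _) (R-injective z c) q
      transport : ∀ n₀ → n₀ ≤ n →
          (disk (F A y) m ≅ disk (F B z) m)
        × (∀ x → InDisk (F A y) m (R A y x) → InDisk A n₀ x)
        × (∀ x → InDisk (F B z) m (R B z x) → InDisk B n₀ x)
        × (∀ {w x x'} → Reach (disk A n₀) w x → Reach (disk B n₀) w x' →
             InDisk (F A y) m (R A y x) ⊎ InDisk (F B z) m (R B z x') →
             Corr (disk (F A y) m) (disk (F B z) m) (R A y x) (R B z x')) →
        ContinuousAt ℓ ℓ' m n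
      transport n₀ l (c₁ , c₂ , c₃ , c₄) =
        ≅-trans (≅-disk (extend-graph ℓ gA) (F-graph y) m (extend-≅ ℓ y))
          (≅-trans c₁ (≅-sym (≅-disk (extend-graph ℓ' gB) (F-graph z) m (extend-≅ ℓ' z)))) ,
        (λ x → DistLe-mono (s≤s l) ∘ c₂ x ∘ distA) ,
        (λ x → DistLe-mono (s≤s l) ∘ c₃ x ∘ distB) ,
        corr
        where
        corr : ∀ {w x x'} → Reach (disk A n) w x → Reach (disk B n) w x' →
               InDisk (extend A ℓ) m x ⊎ InDisk (extend B ℓ') m x' →
               Corr (disk (extend A ℓ) m) (disk (extend B ℓ') m) x x'
        corr {w} {x} {x'} p q d =
          let d' = Sum.map distA distB d
              -- The given paths live in the disk of radius `n`, while `c₄` expects paths in that of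
              -- radius `n₀`; `c₂` and `c₃` supply the distance bound for shortening them.
              r , l' , p' , q' = short-corr gA gB i l (w , p , q) (Sum.map (c₂ x) (c₃ x') d')
              v , p″ , q″ = c₄ (reach-disk l' p') (reach-disk l' q') d'
          in v , backA p″ , backB q″

  -- Left abstract because unfolding it makes conversion checking intractable.
  abstract
    local : YBar A → ∀ v → Local A v
    local yb v = YSet-or-deep yb v (suc b)

  -- The extended dynamics and its properties

  extension : Dynamics (YBar {L} {D} {P})
  extension = record
    { F      = λ A yb → extend A (local yb)
    ; F-in   = λ A yb → extend-YBar (local yb) yb
    ; R      = λ A yb → id
    ; F-cong = λ s t → extend-cong (local s) (local t) (proj₁ s) (proj₁ t)
    ; R-cong = λ s t i {w} p q → extend-corr (local s) (local t) (proj₁ s) (proj₁ t) i (w , p , q) }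

  extension-continuous : Continuous extension
  extension-continuous A s m = go (YSet-or-deep-pt s (suc m + suc b))
    where
    go : YSet A ⊎ Deep A (suc m + suc b) (pt A) →
         ∃ λ n → ∀ B (t : YBar B) → disk A n ≅ disk B n → ContinuousAt (local s) (local t) m n
    go (inj₂ h) = suc m + suc b , λ B t → continuous-deep (local s) (local t) m s t h ≤-refl
    go (inj₁ y@(gA , X , gX , u , i)) = n₀ + k₀ , λ B t j → go' B t j (YSet-or-deep-pt t k₀)
      where
      n₀ = proj₁ (continuous A y m)
      -- One more than the depth of the pointer of `A`: the common disk then rules out a pointer of
      -- `B` that is `k₀` deep, and the dichotomy puts `B` in `YSet`.
      k₀  = suc (depth {X = X} u)
      gU = repoint-graph (attach-graph gX) u
      not-deep : ¬ Deep A k₀ (pt A)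
      not-deep h = 1+n≰n (attach-deep {X = X} {y = u} (deep-repoint {G = Attach X} {u = u}
        (let s , _ = ≅⇒bisim (graph-det gA) (graph-det gU) i in sim-deep s (point s) h)))
      go' : ∀ B (t : YBar B) → disk A (n₀ + k₀) ≅ disk B (n₀ + k₀) → YSet B ⊎ Deep B k₀ (pt B) →
            ContinuousAt (local s) (local t) m (n₀ + k₀)
      go' B t j (inj₁ z) = continuous-YSet (local s) (local t) m y z (m≤m+n n₀ k₀) j
      go' B t j (inj₂ h) = ⊥-elim (not-deep
        (≅-disk-deep (proj₁ t) gA (≅-sym j) (≤-trans (m≤n+m k₀ n₀) (n≤1+n _)) h))

  extension-shift : ShiftInvariant extension
  extension-shift A s u t =
    bisim⇒≅ (graph-det (repoint-graph (extend-graph (local s) (proj₁ s)) u)) bs ,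
    λ x q p → let _ , p' , c = sim-walk (proj₁ bs) (point (proj₁ bs)) p
              in subst (Walk (extend A (local s)) u q) (sym c) (walk-unrepoint p')
    where bs = extend-repoint-bisim u (local s) (local t)

  extension-bounded : Bounded extension
  extension-bounded = 0 , λ A s y → y , [] , z≤n , []

  extension-bijective : VertexPreserving extension
  extension-bijective A s = id , λ y → y , id

  -- Attached graphs lie in `YSet`, so the given quiescence is pulled back along `R` with the same
  -- bound.
  extension-quiescent : IMQuiescent extension
  extension-quiescent = b , λ X gX s t l y r sy x p →
    let z         = attach-YSet gX y
        _ , s'    = extend-bisim (local sy) z
        _ , q , c = sim-walk s' (point s') (quiet X gX s t l y r z x p)
    in subst (Reach (extend (repoint (Attach X) y) (local sy)) (treeWord t)) (R-injective z c) q

  extension-extends : Extends extension Dy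
  extension-extends A y yb = extend-≅ (local yb) y ,
    λ _ → bisim-corr (extend-graph (local yb) (proj₁ yb)) (extend-bisim (local yb) y) refl

theorem11 : (s d p : ℕ) (Dy : Dynamics (YSet {Fin s} {Fin d} {Fin p})) → IsIMCGD Dy →
    Σ (Dynamics (YBar {Fin s} {Fin d} {Fin p})) (λ D' →
    IsCGD D' × VertexPreserving D' × IMQuiescent D' × Extends D' Dy)
theorem11 s d p Dy ((continuous , shift , _) , bijective , b , quiet) =
  extension , (extension-continuous , extension-shift , extension-bounded) ,
  extension-bijective , extension-quiescent , extension-extends
  where open Extension Dy continuous shift bijective b quiet
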